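{- Let $X$ be a finite set and let $[U,V]$ be a regular interval in $\operatorname{Bip}(X)$. Then the Möbius function of $\operatorname{Bip}(X)$ satisfies $$\mu(U,V)=(-1)^{\operatorname{rk}(V)-\operatorname{rk}(U)}.$$
   Context: A relation $U\subseteq X\times X$ on a finite set $X$ is bipartitional if both $U$ and $(X\times X)\setminus U$ are transitive. $\operatorname{Bip}(X)$ is the set of bipartitional relations on $X$, partially ordered by inclusion. It is a graded poset, and $\operatorname{rk}$ denotes its rank function. For a bipartitional relation $U$, write $x\sim_U y$ if either both or none of $(x,y)$ and $(y,x)$ belong to $U$; this is an equivalence relation on $X$. An interval $[U,V]\subseteq\operatorname{Bip}(X)$ is called regular if every $x\in X$ satisfying $(x,x)\in V\setminus U$ also satisfies $\{y\in X: x\sim_U y\}=\{y\in X: x\sim_V y\}$. -}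

module Defs where

open import Level using (0ℓ)
open import Data.Bool.Properties using () renaming (_≟_ to _≟ᵇ_)
open import Data.Fin using (Fin)
open import Data.Fin.Induction using (spo-wellFounded)
open import Data.Fin.Properties using (all?)
open import Data.Fin.Subset using (Subset; inside; outside; _∈_)
open import Data.Fin.Subset.Properties using (_∈?_; ⊆-antisym)
open import Data.Integer using (ℤ; 0ℤ; 1ℤ; _+_; -_)
open import Data.List using (List; []; _∷_; foldr; map; lookup; cartesianProductWith)
open import Data.List.Membership.Propositional using () renaming (_∈_ to _∈ˡ_)
open import Data.List.Membership.Propositional.Properties using (∈-cartesianProductWith⁺)
import Data.List.Membership.Setoid as Membership
open import Data.List.Relation.Unary.All as All using (All; []; _∷_)
open import Data.List.Relation.Unary.AllPairs using ([]; _∷_)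
open import Data.List.Relation.Unary.Any as Any using (here; there)
open import Data.List.Relation.Unary.Any.Properties using (lookup-index)
open import Data.List.Relation.Unary.Enumerates.Setoid using (IsEnumeration)
open import Data.List.Relation.Unary.Unique.Propositional using (Unique)
open import Data.List.Relation.Unary.Unique.Propositional.Properties using (cartesianProductWith⁺)
import Data.List.Relation.Unary.Unique.Setoid as UniqueSetoid
open import Data.Nat using (ℕ; zero; suc)
open import Data.Product using (_×_; _,_; ∃)
open import Data.Sum using (_⊎_)
open import Data.Vec as Vec using (Vec)
open import Data.Vec.Properties using (∷-injective; ≡-dec)
open import Function.Bundles using (_⇔_)
open import Induction.WellFounded using (Acc; acc; WellFounded; module Subrelation)
open import Relation.Binary.Bundles using (Poset; DecPoset; Setoid)
open import Relation.Binary.Core using (Rel)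
open import Relation.Binary.Definitions using (Transitive; Decidable)
open import Relation.Binary.Structures using (IsStrictPartialOrder)
import Relation.Binary.Construct.NonStrictToStrict as ToStrict
import Relation.Binary.Construct.On as On
open import Relation.Binary.PropositionalEquality
  using (_≡_; refl; sym; trans; cong; cong₂; subst; isEquivalence)
open import Relation.Nullary using (¬_; Dec; yes; no)
open import Relation.Nullary.Decidable using (¬?; _×-dec_; _→-dec_; map′)

record FinitePoset : Set₁ where
  field
    decPoset : DecPoset 0ℓ 0ℓ 0ℓ
  open DecPoset decPoset public
  setoid : Setoid 0ℓ 0ℓ
  setoid = Poset.Eq.setoid poset
  field
    elements : List Carrier
    complete : IsEnumeration setoid elements
    unique   : UniqueSetoid.Unique setoid elements

  open ToStrict _≈_ _≤_ public using (_<_; <-isStrictPartialOrder; <-decidable)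

  infix 4 _<?_ _⋖_

  _<?_ : Decidable _<_
  _<?_ = <-decidable _≟_ _≤?_

  _⋖_ : Rel Carrier 0ℓ
  x ⋖ y = x < y × ¬ (∃ λ z → x < z × z < y)

  -- A poset carrying such a ρ is graded by it; on a finite poset ρ is
  -- uniquely determined by these conditions.
  record IsRankFunction (ρ : Carrier → ℕ) : Set where
    field
      rank-cong    : ∀ {x y} → x ≈ y → ρ x ≡ ρ y
      rank-minimal : ∀ {x} → (∀ y → y ≤ x → y ≈ x) → ρ x ≡ 0
      rank-cover   : ∀ {x y} → x ⋖ y → ρ y ≡ suc (ρ x)

  private
    module SPO = IsStrictPartialOrder (<-isStrictPartialOrder isPartialOrder)

    pos : Carrier → Fin _
    pos x = Any.index (complete x)

    _⊏_ : Rel (Fin _) 0ℓ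
    i ⊏ j = lookup elements i < lookup elements j

    ⊏-wellFounded : WellFounded _⊏_
    ⊏-wellFounded = spo-wellFounded
      (On.isStrictPartialOrder (lookup elements) (<-isStrictPartialOrder isPartialOrder))

    ≈-pos : ∀ x → x ≈ lookup elements (pos x)
    ≈-pos x = lookup-index (complete x)

  <-wellFounded : WellFounded _<_
  <-wellFounded = Subrelation.wellFounded
    (λ {x} {y} x<y → SPO.<-respʳ-≈ (≈-pos y) (SPO.<-respˡ-≈ (≈-pos x) x<y))
    (On.wellFounded pos ⊏-wellFounded)

  -- μ(u,u) = 1 and μ(u,v) = - Σ_{u ≤ w < v} μ(u,w) for u < v.  When u ≰ v
  -- the sum has no nonzero terms, giving the convention μ(u,v) = 0.
  mutual
    μ-acc : ∀ u v → Acc _<_ v → ℤ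
    μ-acc u v (acc rs) with u ≟ v
    ... | yes _ = 1ℤ
    ... | no  _ = - foldr _+_ 0ℤ (map (μ-term u v rs) elements)

    μ-term : ∀ u v → (∀ {w} → w < v → Acc _<_ w) → Carrier → ℤ
    μ-term u v rs w with u ≤? w | w <? v
    ... | yes _ | yes w<v = μ-acc u w (rs w<v)
    ... | yes _ | no  _   = 0ℤ
    ... | no  _ | _       = 0ℤ

  μ : Carrier → Carrier → ℤ
  μ u v = μ-acc u v (<-wellFounded v)

-- A subset of Fin n × Fin n, stored as its rows: row x is { y ∣ (x , y) ∈ R }.
Relation : ℕ → Set
Relation n = Vec (Subset n) n

infix 4 _[_,_]
_[_,_] : ∀ {n} → Relation n → Fin n → Fin n → Set
R [ x , y ] = y ∈ Vec.lookup R x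

_[_,_]? : ∀ {n} (R : Relation n) x y → Dec (R [ x , y ])
R [ x , y ]? = y ∈? Vec.lookup R x

IsBipartitional : ∀ {n} → Relation n → Set
IsBipartitional R = Transitive (λ x y → R [ x , y ]) × Transitive (λ x y → ¬ R [ x , y ])

Same : ∀ {n} → Relation n → Fin n → Fin n → Set
Same R x y = (R [ x , y ] × R [ y , x ]) ⊎ (¬ R [ x , y ] × ¬ R [ y , x ])

record Bip (n : ℕ) : Set where
  constructor _,_
  field
    rel             : Relation n
    isBipartitional : IsBipartitional rel
open Bip public

infix 4 _⊆_
_⊆_ : ∀ {n} → Bip n → Bip n → Set
U ⊆ V = ∀ x y → rel U [ x , y ] → rel V [ x , y ]

IsRegular : ∀ {n} → Bip n → Bip n → Set
IsRegular U V = ∀ x → rel V [ x , x ] → ¬ rel U [ x , x ] →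
                ∀ y → Same (rel U) x y ⇔ Same (rel V) x y

private
  dec-trans : ∀ {n} {R : Fin n → Fin n → Set} → Decidable R → Dec (Transitive R)
  dec-trans R? = map′ (λ t {x} {y} {z} → t x y z) (λ t x y z → t {x} {y} {z})
    (all? λ x → all? λ y → all? λ z → R? x y →-dec (R? y z →-dec R? x z))

isBipartitional? : ∀ {n} (R : Relation n) → Dec (IsBipartitional R)
isBipartitional? R =
  dec-trans (λ x y → R [ x , y ]?) ×-dec dec-trans (λ x y → ¬? (R [ x , y ]?))

-- Elements of Bip n are compared through their underlying relations, the
-- transitivity proofs being disregarded.
bipDecPoset : ℕ → DecPoset 0ℓ 0ℓ 0ℓ
bipDecPoset n = record
  { Carrier = Bip n
  ; _≈_ = λ U V → rel U ≡ rel V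
  ; _≤_ = _⊆_
  ; isDecPartialOrder = record
    { isPartialOrder = record
      { isPreorder = record
        { isEquivalence = On.isEquivalence rel isEquivalence
        ; reflexive = λ { eq x y → subst (_[ x , y ]) eq }
        ; trans = λ p q x y r → q x y (p x y r)
        }
      ; antisym = λ p q → rows-ext λ x → ⊆-antisym (λ {y} → p x y) (λ {y} → q x y)
      }
    ; _≟_ = λ U V → ≡-dec (≡-dec _≟ᵇ_) (rel U) (rel V)
    ; _≤?_ = λ U V → all? λ x → all? λ y → (rel U [ x , y ]?) →-dec (rel V [ x , y ]?)
    }
  }
  where
  rows-ext : ∀ {A : Set} {m} {xs ys : Vec A m} →
             (∀ i → Vec.lookup xs i ≡ Vec.lookup ys i) → xs ≡ ys
  rows-ext {xs = Vec.[]} {Vec.[]} _ = refl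
  rows-ext {xs = x Vec.∷ xs} {y Vec.∷ ys} eq =
    cong₂ Vec._∷_ (eq Fin.zero) (rows-ext (λ i → eq (Fin.suc i)))

vectors : ∀ {A : Set} → List A → ∀ m → List (Vec A m)
vectors xs zero    = Vec.[] ∷ []
vectors xs (suc m) = cartesianProductWith Vec._∷_ xs (vectors xs m)

relations : ∀ n → List (Relation n)
relations n = vectors (vectors (outside ∷ inside ∷ []) n) n

bipartitionals : ∀ {n} → List (Relation n) → List (Bip n)
bipartitionals []       = []
bipartitionals (R ∷ Rs) with isBipartitional? R
... | yes b = (R , b) ∷ bipartitionals Rs
... | no  _ = bipartitionals Rs

bip : ℕ → FinitePoset
bip n = record
  { decPoset = bipDecPoset n
  ; elements = bipartitionals (relations n)
  ; complete = λ U → bipartitionals-complete U (relations-complete (rel U))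
  ; unique   = bipartitionals-unique relations-unique
  }
  where
  BipSetoid : Setoid 0ℓ 0ℓ
  BipSetoid = Poset.Eq.setoid (DecPoset.poset (bipDecPoset n))

  module B = Membership BipSetoid
  module U = UniqueSetoid BipSetoid

  vectors-complete : ∀ {A : Set} {xs : List A} → (∀ x → x ∈ˡ xs) →
                     ∀ {m} (v : Vec A m) → v ∈ˡ vectors xs m
  vectors-complete all Vec.[]       = here refl
  vectors-complete all (x Vec.∷ v) =
    ∈-cartesianProductWith⁺ Vec._∷_ (all x) (vectors-complete all v)

  vectors-unique : ∀ {A : Set} {xs : List A} → Unique xs → ∀ m → Unique (vectors xs m)
  vectors-unique xs! zero    = [] ∷ []
  vectors-unique xs! (suc m) =
    cartesianProductWith⁺ Vec._∷_ ∷-injective xs! (vectors-unique xs! m)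

  relations-complete : ∀ R → R ∈ˡ relations n
  relations-complete = vectors-complete (vectors-complete
    λ { outside → here refl ; inside → there (here refl) })

  relations-unique : Unique (relations n)
  relations-unique = vectors-unique (vectors-unique (((λ ()) ∷ []) ∷ [] ∷ []) n) n

  bipartitionals-complete : ∀ (U : Bip n) {Rs} → rel U ∈ˡ Rs → U B.∈ bipartitionals Rs
  bipartitionals-complete (R , b) {S ∷ Rs} R∈ with isBipartitional? S | R∈
  ... | yes _  | here eq   = here eq
  ... | yes _  | there R∈′ = there (bipartitionals-complete (R , b) R∈′)
  ... | no  ¬b | here refl with () ← ¬b b
  ... | no  _  | there R∈′ = bipartitionals-complete (R , b) R∈′

  bipartitionals-fresh : ∀ {R Rs} → All (λ S → ¬ R ≡ S) Rs →
                         All (λ V → ¬ R ≡ rel V) (bipartitionals Rs)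
  bipartitionals-fresh [] = []
  bipartitionals-fresh {Rs = S ∷ _} (R≢S ∷ fresh) with isBipartitional? S
  ... | yes _ = R≢S ∷ bipartitionals-fresh fresh
  ... | no  _ = bipartitionals-fresh fresh

  bipartitionals-unique : ∀ {Rs} → Unique Rs → U.Unique (bipartitionals Rs)
  bipartitionals-unique [] = []
  bipartitionals-unique {R ∷ _} (fresh ∷ Rs!) with isBipartitional? R
  ... | yes _ = bipartitionals-fresh fresh ∷ bipartitionals-unique Rs!
  ... | no  _ = bipartitionals-unique Rs!

{-# OPTIONS --safe #-}

-- Put f(U, W) = (-1)^(rk U + rk W) if [U, W] is regular and 0 otherwise.  To get
-- μ = f it suffices that Σ f(U, W) over U ⊆ W ⊆ V vanishes whenever U ⊂ V, and
-- this follows from a perfect matching of {W | U ⊆ W ⊆ V, [U, W] regular} whose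
-- pairs have ranks of opposite parity.  A regular W ⊇ U arises from U by merging
-- runs of consecutive underlined blocks and by independently either refining each
-- nonunderlined block into an ordered partition or underlining it as a whole.
-- One of three matchings applies.
--   * If V merges two consecutive underlined blocks of U, toggle that merging.
--   * If V separates a nonunderlined block B of U into a part S before a part T,
--     toggle whether the last block of W meeting S and the first one meeting T
--     coincide.
--   * If V contains B × B for a nonunderlined block B of U, scan B in increasing
--     order for the first element a such that {a} is not the next block of W, and
--     move a into the block preceding it, or out of its block to just after it.
--     What remains, the increasing ordered partition of B into singletons and B
--     underlined as a whole, differ by a chain of 2|B| - 1 covers.
-- All other partners are covers of each other, so no formula for rk is needed.

module Submission where

open import Defs
open import Data.Bool using (true)
open import Data.Empty using (⊥-elim)
open import Data.Fin using (Fin; toℕ)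
open import Data.Fin.Induction using (spo-noetherian; spo-wellFounded)
open import Data.Fin.Properties using (all?; any?; toℕ-injective; toℕ<n) renaming (_≟_ to _≟ᶠ_)
open import Data.Integer
  using (ℤ; 0ℤ; 1ℤ; -1ℤ; +[1+_]; -[1+_]; _+_; _*_; -_; _^_)
  renaming (+_ to pos)
import Data.Integer.Properties as ℤ
open import Data.List using (List; []; _∷_; foldr; lookup; map)
open import Data.List.Relation.Unary.All as All using (All; []; _∷_)
open import Data.List.Relation.Unary.AllPairs using (AllPairs; _∷_)
open import Data.List.Relation.Unary.Any as Any using (Any; here; there)
open import Data.List.Relation.Unary.Any.Properties using (lookup-index)
open import Data.Nat as ℕ using (ℕ; zero; suc; _∸_)
import Data.Nat.Properties as ℕ
open import Data.Product using (_×_; _,_; ∃; ∃₂; proj₁; proj₂; uncurry)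
open import Data.Sum using (_⊎_; inj₁; inj₂; [_,_]′)
open import Data.Unit using (⊤; tt)
open import Data.Vec as Vec using (tabulate)
open import Data.Vec.Properties using (lookup∘tabulate; []=⇒lookup; lookup⇒[]=)
open import Function using (_∘_; id; flip)
open import Function.Bundles using (_⇔_; mk⇔; module Equivalence)
open import Induction.WellFounded using (Acc; acc; WellFounded; module Subrelation)
import Relation.Binary.Construct.On as On
open import Relation.Binary.Definitions using (tri<; tri≈; tri>)
open import Relation.Binary.PropositionalEquality
  using (_≡_; refl; sym; trans; cong; cong₂; subst; isEquivalence; module ≡-Reasoning)
open import Relation.Binary.Structures using (IsStrictPartialOrder)
open import Relation.Nullary using (¬_; Dec; yes; no; does)
open import Relation.Nullary.Decidable
  using (¬?; _×-dec_; _→-dec_; _⊎-dec_; map′; dec-true; decidable-stable)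

open Equivalence using (to; from)

-- Indicator terms, finite sums of integers, and powers of -1.

χ : {A : Set} → Dec A → ℤ → ℤ
χ (yes _) i = i
χ (no _)  i = 0ℤ

χ-true : ∀ {A : Set} (d : Dec A) {i} → A → χ d i ≡ i
χ-true (yes _) a = refl
χ-true (no ¬a) a = ⊥-elim (¬a a)

χ-false : ∀ {A : Set} (d : Dec A) {i} → ¬ A → χ d i ≡ 0ℤ
χ-false (yes a) ¬a = ⊥-elim (¬a a)
χ-false (no _)  ¬a = refl

χ-cong : ∀ {A B : Set} (d : Dec A) (e : Dec B) {i} → (A → B) → (B → A) → χ d i ≡ χ e i
χ-cong (yes a) e f g = sym (χ-true e (f a))
χ-cong (no ¬a) e f g = sym (χ-false e (¬a ∘ g))

sum : ∀ {A : Set} → List A → (A → ℤ) → ℤ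
sum xs f = foldr _+_ 0ℤ (map f xs)

module _ {A : Set} where

  sum-cong : ∀ (xs : List A) {f g} → (∀ x → f x ≡ g x) → sum xs f ≡ sum xs g
  sum-cong []       f≗g = refl
  sum-cong (x ∷ xs) f≗g = cong₂ _+_ (f≗g x) (sum-cong xs f≗g)

  sum-zero : ∀ (xs : List A) → sum xs (λ _ → 0ℤ) ≡ 0ℤ
  sum-zero []       = refl
  sum-zero (x ∷ xs) = trans (ℤ.+-identityˡ _) (sum-zero xs)

  sum-+ : ∀ (xs : List A) f g → sum xs (λ x → f x + g x) ≡ sum xs f + sum xs g
  sum-+ []       f g = refl
  sum-+ (x ∷ xs) f g = begin
    f x + g x + sum xs (λ x → f x + g x)  ≡⟨ cong (f x + g x +_) (sum-+ xs f g) ⟩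
    f x + g x + (sum xs f + sum xs g)     ≡⟨ ℤ.+-assoc (f x) (g x) _ ⟩
    f x + (g x + (sum xs f + sum xs g))   ≡⟨ cong (f x +_) (ℤ.+-assoc (g x) _ _) ⟨
    f x + (g x + sum xs f + sum xs g)     ≡⟨ cong (λ i → f x + (i + sum xs g)) (ℤ.+-comm (g x) _) ⟩
    f x + (sum xs f + g x + sum xs g)     ≡⟨ cong (f x +_) (ℤ.+-assoc (sum xs f) _ _) ⟩
    f x + (sum xs f + (g x + sum xs g))   ≡⟨ ℤ.+-assoc (f x) _ _ ⟨
    f x + sum xs f + (g x + sum xs g)     ∎
    where open ≡-Reasoning

  sum-* : ∀ (xs : List A) c f → sum xs (λ x → c * f x) ≡ c * sum xs f
  sum-* []       c f = sym (ℤ.*-zeroʳ c)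
  sum-* (x ∷ xs) c f = trans (cong (c * f x +_) (sum-* xs c f)) (sym (ℤ.*-distribˡ-+ c _ _))

  sum-neg : ∀ (xs : List A) f → sum xs (λ x → - f x) ≡ - sum xs f
  sum-neg []       f = refl
  sum-neg (x ∷ xs) f = trans (cong (- f x +_) (sum-neg xs f)) (sym (ℤ.neg-distrib-+ (f x) _))

sum-swap : ∀ {A B : Set} (xs : List A) (ys : List B) (f : A → B → ℤ) →
           sum xs (λ x → sum ys (f x)) ≡ sum ys (λ y → sum xs (λ x → f x y))
sum-swap []       ys f = sym (sum-zero ys)
sum-swap (x ∷ xs) ys f =
  trans (cong (sum ys (f x) +_) (sum-swap xs ys f)) (sym (sum-+ ys _ _))

self-negative⇒0 : ∀ {i} → i ≡ - i → i ≡ 0ℤ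
self-negative⇒0 {pos zero}    _ = refl
self-negative⇒0 {+[1+ _ ]}  ()
self-negative⇒0 { -[1+ _ ]} ()

sign : ℕ → ℤ
sign k = -1ℤ ^ k

sign-suc : ∀ k → sign (suc k) ≡ - sign k
sign-suc k = ℤ.-1*i≡-i (sign k)

sign-square : ∀ k → sign k * sign k ≡ 1ℤ
sign-square zero    = refl
sign-square (suc k) = begin
  sign (suc k) * sign (suc k)  ≡⟨ cong₂ _*_ (sign-suc k) (sign-suc k) ⟩
  - sign k * - sign k          ≡⟨ ℤ.neg-distribˡ-* (sign k) (- sign k) ⟨
  - (sign k * - sign k)        ≡⟨ cong -_ (ℤ.neg-distribʳ-* (sign k) (sign k)) ⟨
  - - (sign k * sign k)        ≡⟨ ℤ.neg-involutive _ ⟩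
  sign k * sign k              ≡⟨ sign-square k ⟩
  1ℤ                           ∎
  where open ≡-Reasoning

sign-∸ : ∀ {a b} → a ℕ.≤ b → sign a * sign b ≡ sign (b ∸ a)
sign-∸ {a} {b} a≤b = begin
  sign a * sign b                   ≡⟨ cong (λ k → sign a * sign k) (ℕ.m+[n∸m]≡n a≤b) ⟨
  sign a * sign (a ℕ.+ (b ∸ a))     ≡⟨ cong (sign a *_) (ℤ.^-distribˡ-+-* -1ℤ a (b ∸ a)) ⟩
  sign a * (sign a * sign (b ∸ a))  ≡⟨ ℤ.*-assoc (sign a) _ _ ⟨
  sign a * sign a * sign (b ∸ a)    ≡⟨ cong (_* sign (b ∸ a)) (sign-square a) ⟩
  1ℤ * sign (b ∸ a)                 ≡⟨ ℤ.*-identityˡ _ ⟩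
  sign (b ∸ a)                      ∎
  where open ≡-Reasoning

-- The Möbius function, ranks and sign-reversing matchings in a finite poset.

module Sums (P : FinitePoset) where
  open FinitePoset P renaming (refl to ≤-refl; trans to ≤-trans)
  private
    module ≈ = Eq
    module SPO = IsStrictPartialOrder (<-isStrictPartialOrder isPartialOrder)

  Σ[_] : (Carrier → ℤ) → ℤ
  Σ[_] = sum elements

  sum-δ : ∀ c i → Σ[ (λ x → χ (c ≟ x) i) ] ≡ i
  sum-δ c i = present unique (complete c)
    where
    absent : ∀ {xs} → All (λ x → ¬ c ≈ x) xs → sum xs (λ x → χ (c ≟ x) i) ≡ 0ℤ
    absent []             = refl
    absent {x ∷ _} (c≉x ∷ c≉) = cong₂ _+_ (χ-false (c ≟ x) c≉x) (absent c≉)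

    present : ∀ {xs} → AllPairs (λ x y → ¬ x ≈ y) xs → Any (c ≈_) xs →
              sum xs (λ x → χ (c ≟ x) i) ≡ i
    present {x ∷ _} (x≉ ∷ _) (here c≈x) = trans
      (cong₂ _+_ (χ-true (c ≟ x) c≈x)
        (absent (All.map (λ x≉y c≈y → x≉y (≈.trans (≈.sym c≈x) c≈y)) x≉)))
      (ℤ.+-identityʳ i)
    present {x ∷ _} (x≉ ∷ xs!) (there c∈) = trans
      (cong₂ _+_ (χ-false (c ≟ x) λ c≈x → differ c≈x x≉ c∈) (present xs! c∈))
      (ℤ.+-identityˡ i)
      where
      differ : ∀ {ys} → c ≈ x → All (λ y → ¬ x ≈ y) ys → ¬ Any (c ≈_) ys
      differ c≈x (x≉y ∷ _) (here c≈y)  = x≉y (≈.trans (≈.sym c≈x) c≈y)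
      differ c≈x (_ ∷ x≉)  (there c∈′) = differ c≈x x≉ c∈′

  -- Each `f x` is the sum over y of `χ (φ x ≟ y) (f x)`. In the resulting double sum, exchanging x
  -- and y reverses the sign of the summand, so Σ f = - Σ f. This replaces reindexing the list along
  -- `φ`.
  sum-involution : ∀ (φ : Carrier → Carrier) f → (∀ {x y} → φ x ≈ y → φ y ≈ x) →
                   (∀ {x y} → φ x ≈ y → f x ≡ - f y) → Σ[ f ] ≡ 0ℤ
  sum-involution φ f φ-sym f-odd = self-negative⇒0 (begin
    Σ[ f ]
      ≡⟨ sum-cong elements (λ x → sum-δ (φ x) (f x)) ⟨
    Σ[ (λ x → Σ[ (λ y → χ (φ x ≟ y) (f x)) ]) ]
      ≡⟨ sum-cong elements (λ x → sum-cong elements (exchange x)) ⟩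
    Σ[ (λ x → Σ[ (λ y → χ (φ y ≟ x) (- f y)) ]) ]
      ≡⟨ sum-swap elements elements _ ⟩
    Σ[ (λ y → Σ[ (λ x → χ (φ y ≟ x) (- f y)) ]) ]
      ≡⟨ sum-cong elements (λ y → sum-δ (φ y) (- f y)) ⟩
    Σ[ (λ y → - f y) ]
      ≡⟨ sum-neg elements f ⟩
    - Σ[ f ] ∎)
    where
    open ≡-Reasoning
    exchange : ∀ x y → χ (φ x ≟ y) (f x) ≡ χ (φ y ≟ x) (- f y)
    exchange x y with φ x ≟ y
    ... | yes φx≈y = trans (f-odd φx≈y) (sym (χ-true (φ y ≟ x) (φ-sym φx≈y)))
    ... | no  φx≉y = sym (χ-false (φ y ≟ x) (φx≉y ∘ φ-sym))

  module _ (F : Carrier → Carrier → ℤ)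
           (F-congʳ : ∀ {u v w} → v ≈ w → F u v ≡ F u w)
           (F-diagonal : ∀ {u v} → u ≈ v → F u v ≡ 1ℤ)
           (F-sum : ∀ {u v} → u < v → Σ[ (λ w → χ (u ≤? w ×-dec w ≤? v) (F u w)) ] ≡ 0ℤ)
           where

    -- The recursion for μ sums over w < v, but `F-sum` over w ≤ v. The difference is the term at w
    -- = v, which `term` records as a delta at v carrying `- F u v`; the other terms agree by
    -- induction on accessibility.
    μ-acc-unique : ∀ {u v} → u ≤ v → (a : Acc _<_ v) → μ-acc u v a ≡ F u v
    μ-acc-unique {u} {v} u≤v (acc rs) with u ≟ v
    ... | yes u≈v = sym (F-diagonal u≈v)
    ... | no  u≉v = begin
      - sum elements (μ-term u v rs)
        ≡⟨ cong -_ (sum-cong elements term) ⟩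
      - sum elements (λ w → g w + χ (v ≟ w) (- F u v))
        ≡⟨ cong -_ (sum-+ elements g _) ⟩
      - (Σ[ g ] + Σ[ (λ w → χ (v ≟ w) (- F u v)) ])
        ≡⟨ cong -_ (cong₂ _+_ (F-sum (u≤v , u≉v)) (sum-δ v (- F u v))) ⟩
      - (0ℤ + - F u v)
        ≡⟨ cong -_ (ℤ.+-identityˡ _) ⟩
      - - F u v
        ≡⟨ ℤ.neg-involutive _ ⟩
      F u v ∎
      where
      open ≡-Reasoning
      g : Carrier → ℤ
      g w = χ (u ≤? w ×-dec w ≤? v) (F u w)

      term : ∀ w → μ-term u v rs w ≡ g w + χ (v ≟ w) (- F u v)
      term w with u ≤? w | w <? v
      ... | no u≰w  | _ = sym (cong (0ℤ +_) (χ-false (v ≟ w) λ v≈w → u≰w (≤-respʳ-≈ v≈w u≤v)))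
      ... | yes u≤w | yes w<v with w ≤? v
      ...   | yes _   = trans (μ-acc-unique u≤w (rs w<v)) (sym (trans
              (cong (F u w +_) (χ-false (v ≟ w) λ v≈w → proj₂ w<v (≈.sym v≈w)))
              (ℤ.+-identityʳ _)))
      ...   | no  w≰v = ⊥-elim (w≰v (proj₁ w<v))
      term w | yes u≤w | no w≮v with w ≤? v
      ...   | no  w≰v = sym (cong (0ℤ +_) (χ-false (v ≟ w) (λ v≈w → w≰v (reflexive (≈.sym v≈w)))))
      ...   | yes w≤v with v ≟ w
      ...     | yes v≈w = sym (trans (cong (λ i → F u w + - i) (F-congʳ v≈w)) (ℤ.+-inverseʳ (F u w)))
      ...     | no  v≉w = ⊥-elim (w≮v (w≤v , v≉w ∘ ≈.sym))

  between? : ∀ x y → Dec (∃ λ z → x < z × z < y)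
  between? x y = map′ Any.satisfied (λ (z , p) → Any.map (λ z≈w → resp z≈w p) (complete z))
    (Any.any? (λ z → (x <? z) ×-dec (z <? y)) elements)
    where
    resp : ∀ {z w} → z ≈ w → x < z × z < y → x < w × w < y
    resp z≈w (x<z , z<y) = SPO.<-respʳ-≈ z≈w x<z , SPO.<-respˡ-≈ z≈w z<y

  private
    position : Carrier → Fin _
    position x = Any.index (complete x)

    ≈-position : ∀ x → x ≈ lookup elements (position x)
    ≈-position x = lookup-index (complete x)

  <-noetherian : WellFounded (flip _<_)
  <-noetherian = Subrelation.wellFounded
    (λ {x} {y} y<x → SPO.<-respʳ-≈ (≈-position x) (SPO.<-respˡ-≈ (≈-position y) y<x))
    (On.wellFounded position (spo-noetherian
      (On.isStrictPartialOrder (lookup elements) (<-isStrictPartialOrder isPartialOrder))))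

  -- Any z strictly between takes the place of y, and well-foundedness ends the search at a cover.
  cover-below : ∀ {x y} → Acc _<_ y → x < y → ∃ λ z → x ⋖ z × z ≤ y
  cover-below {x} {y} (acc rs) x<y with between? x y
  ... | no  ¬z             = y , (x<y , ¬z) , reflexive ≈.refl
  ... | yes (z , x<z , z<y) with cover-below (rs z<y) x<z
  ...   | w , x⋖w , w≤z = w , x⋖w , ≤-trans w≤z (proj₁ z<y)

  -- The rank is controlled along covers, so x climbs towards y one cover at a time.
  rank-mono : ∀ {rk} → IsRankFunction rk → ∀ {x y} → x ≤ y → rk x ℕ.≤ rk y
  rank-mono {rk} isRank {x} {y} = go (<-noetherian x)
    where
    open IsRankFunction isRank
    go : ∀ {x} → Acc (flip _<_) x → x ≤ y → rk x ℕ.≤ rk y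
    go {x} (acc rs) x≤y with x ≟ y
    ... | yes x≈y = ℕ.≤-reflexive (rank-cong x≈y)
    ... | no  x≉y with cover-below (<-wellFounded y) (x≤y , x≉y)
    ...   | z , x⋖z , z≤y =
      ℕ.≤-trans (ℕ.n≤1+n _) (ℕ.≤-trans (ℕ.≤-reflexive (sym (rank-cover x⋖z)))
        (go (rs (proj₁ x⋖z)) z≤y))

  -- A perfect matching of P along N, with the lower partner listed first.
  record Pairing (P : Carrier → Set) (N : Carrier → Carrier → Set) (rk : Carrier → ℕ) : Set where
    field
      P-resp  : ∀ {x y} → x ≈ y → P x → P y
      N-respˡ : ∀ {x x′ y} → x ≈ x′ → N x y → N x′ y
      N-respʳ : ∀ {x y y′} → y ≈ y′ → N x y → N x y′
      partner : ∀ {x} → P x → ∃ λ y → P y × (N x y ⊎ N y x)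
      upper-unique : ∀ {x y y′} → P x → P y → P y′ → N x y → N x y′ → y ≈ y′
      lower-unique : ∀ {x x′ y} → P x → P x′ → P y → N x y → N x′ y → x ≈ x′
      lower≢upper  : ∀ {x y z} → P x → P y → P z → N x y → ¬ N y z
      parity  : ∀ {x y} → P x → P y → N x y → sign (rk y) ≡ - sign (rk x)

  module SignedSums (rk : Carrier → ℕ) where

    signedSum : {P : Carrier → Set} → (∀ x → Dec (P x)) → ℤ
    signedSum P? = Σ[ (λ x → χ (P? x) (sign (rk x))) ]

    -- The involution exchanges partners inside P and fixes everything outside, where the summand is
    -- 0. The two uniqueness fields and `lower≢upper` together make the partner unique, which is
    -- what `φ-sym` needs.
    pairing⇒0 : ∀ {P N} → (P? : ∀ x → Dec (P x)) → Pairing P N rk → signedSum P? ≡ 0ℤ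
    pairing⇒0 {P} {N} P? pairing = sum-involution φ f φ-sym f-odd
      where
      open Pairing pairing

      M : Carrier → Carrier → Set
      M x y = N x y ⊎ N y x

      φ : Carrier → Carrier
      φ x with P? x
      ... | yes p = proj₁ (partner p)
      ... | no  _ = x

      φ-partner : ∀ {x} → P x → P (φ x) × M x (φ x)
      φ-partner {x} p with P? x
      ... | yes p′ = proj₂ (partner p′)
      ... | no  ¬p = ⊥-elim (¬p p)

      φ-fixed : ∀ {x} → ¬ P x → φ x ≡ x
      φ-fixed {x} ¬p with P? x
      ... | yes p = ⊥-elim (¬p p)
      ... | no  _ = refl

      M-unique : ∀ {x y z} → P x → P y → P z → M x y → M x z → y ≈ z
      M-unique p q r (inj₁ a) (inj₁ b) = upper-unique p q r a b
      M-unique p q r (inj₂ a) (inj₂ b) = lower-unique q r p a b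
      M-unique p q r (inj₁ a) (inj₂ b) = ⊥-elim (lower≢upper r p q b a)
      M-unique p q r (inj₂ a) (inj₁ b) = ⊥-elim (lower≢upper q p r a b)

      M-respʳ : ∀ {x y z} → y ≈ z → M x y → M x z
      M-respʳ y≈z (inj₁ a) = inj₁ (N-respʳ y≈z a)
      M-respʳ y≈z (inj₂ a) = inj₂ (N-respˡ y≈z a)

      M-sym : ∀ {x y} → M x y → M y x
      M-sym (inj₁ a) = inj₂ a
      M-sym (inj₂ a) = inj₁ a

      M-parity : ∀ {x y} → P x → P y → M x y → sign (rk x) ≡ - sign (rk y)
      M-parity {x} {y} p q (inj₁ a) =
        trans (sym (ℤ.neg-involutive (sign (rk x)))) (cong -_ (sym (parity p q a)))
      M-parity p q (inj₂ a) = parity q p a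

      f : Carrier → ℤ
      f x = χ (P? x) (sign (rk x))

      φ-sym : ∀ {x y} → φ x ≈ y → φ y ≈ x
      φ-sym {x} {y} φx≈y with P? x
      φ-sym {x} {y} φx≈y | yes p with partner p
      ... | z , q , m = let q′ = P-resp φx≈y q ; r , m′ = φ-partner q′ in
        M-unique q′ r p m′ (M-sym (M-respʳ φx≈y m))
      φ-sym {x} {y} x≈y | no ¬p =
        subst (_≈ x) (sym (φ-fixed (¬p ∘ P-resp (≈.sym x≈y)))) (≈.sym x≈y)

      f-odd : ∀ {x y} → φ x ≈ y → f x ≡ - f y
      f-odd {x} {y} φx≈y with P? x
      f-odd {x} {y} φx≈y | yes p with partner p
      ... | z , q , m = let q′ = P-resp φx≈y q in
        trans (M-parity p q′ (M-respʳ φx≈y m)) (cong -_ (sym (χ-true (P? y) q′)))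
      f-odd {x} {y} x≈y | no ¬p = cong -_ (sym (χ-false (P? y) (¬p ∘ P-resp (≈.sym x≈y))))

    signedSum-cong : ∀ {P Q : Carrier → Set} (P? : ∀ x → Dec (P x)) (Q? : ∀ x → Dec (Q x)) →
                     (∀ {x} → P x → Q x) → (∀ {x} → Q x → P x) → signedSum P? ≡ signedSum Q?
    signedSum-cong P? Q? f g = sum-cong elements λ x → χ-cong (P? x) (Q? x) f g

    -- Allows a family to be matched layer by layer along a chain of subfamilies.
    signedSum-difference : ∀ {P Q : Carrier → Set} (P? : ∀ x → Dec (P x)) (Q? : ∀ x → Dec (Q x)) →
      (∀ {x} → Q x → P x) → signedSum Q? ≡ 0ℤ → signedSum (λ x → P? x ×-dec ¬? (Q? x)) ≡ 0ℤ →
      signedSum P? ≡ 0ℤ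
    signedSum-difference P? Q? Q⊆P Q≡0 P∖Q≡0 = trans (sum-cong elements decompose)
      (trans (sum-+ elements _ _) (cong₂ _+_ Q≡0 P∖Q≡0))
      where
      decompose : ∀ x → χ (P? x) (sign (rk x)) ≡
        χ (Q? x) (sign (rk x)) + χ (P? x ×-dec ¬? (Q? x)) (sign (rk x))
      decompose x with P? x | Q? x
      ... | yes _ | yes _ = sym (ℤ.+-identityʳ _)
      ... | yes _ | no  _ = sym (ℤ.+-identityˡ _)
      ... | no ¬p | yes q = ⊥-elim (¬p (Q⊆P q))
      ... | no  _ | no  _ = refl

-- Bipartitional relations as decidable predicates, and a criterion for covers.

_⇔-dec_ : ∀ {A B : Set} → Dec A → Dec B → Dec (A ⇔ B)
A? ⇔-dec B? = map′ (uncurry mk⇔) (λ e → to e , from e) ((A? →-dec B?) ×-dec (B? →-dec A?))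

-- `R` may relate distinct elements both ways, so minimality is meant up to mutual relation: the
-- descent follows the strict part of `R`, a strict order on a finite set and hence well-founded.
minimal : ∀ {n} {R : Fin n → Fin n → Set} (R? : ∀ x y → Dec (R x y)) →
          (∀ {x y z} → R x y → R y z → R x z) →
          {P : Fin n → Set} (P? : ∀ x → Dec (P x)) → ∃ P →
          ∃ λ m → P m × (∀ {z} → P z → R z m → R m z)
minimal {n} {R} R? R-trans {P} P? (x₀ , p₀) = descend p₀ (wf x₀)
  where
  _⊏_ : Fin n → Fin n → Set
  x ⊏ y = R x y × ¬ R y x

  wf : WellFounded _⊏_
  wf = spo-wellFounded {_⊏_ = _⊏_} record
    { isEquivalence = isEquivalence
    ; irrefl = λ { refl (xx , ¬xx) → ¬xx xx }
    ; trans = λ { (xy , ¬yx) (yz , ¬zy) → R-trans xy yz , λ zx → ¬zy (R-trans zx xy) }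
    ; <-resp-≈ = (λ { refl p → p }) , (λ { refl p → p })
    }

  descend : ∀ {x} → P x → Acc _⊏_ x → ∃ λ m → P m × (∀ {z} → P z → R z m → R m z)
  descend {x} p (acc rs) with any? (λ z → P? z ×-dec R? z x ×-dec ¬? (R? x z))
  ... | yes (z , q , zx , ¬xz) = descend q (rs (zx , ¬xz))
  ... | no  none = x , p , λ {z} q zx → decidable-stable (R? x z) λ ¬xz → none (z , q , zx , ¬xz)

module _ {n : ℕ} where

  infix 4 _⟨_,_⟩ _≈_

  _⟨_,_⟩ : Bip n → Fin n → Fin n → Set
  W ⟨ x , y ⟩ = rel W [ x , y ]

  _⟨_,_⟩? : ∀ W x y → Dec (W ⟨ x , y ⟩)
  W ⟨ x , y ⟩? = rel W [ x , y ]?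

  _≈_ : Bip n → Bip n → Set
  W ≈ W′ = rel W ≡ rel W′

  transitive : ∀ W {x y z} → W ⟨ x , y ⟩ → W ⟨ y , z ⟩ → W ⟨ x , z ⟩
  transitive W = proj₁ (isBipartitional W)

  -- Transitivity of the complement, contraposed and made a disjunction by decidability.
  cotransitive : ∀ W {x z} y → W ⟨ x , z ⟩ → W ⟨ x , y ⟩ ⊎ W ⟨ y , z ⟩
  cotransitive W {x} {z} y xz with W ⟨ x , y ⟩? | W ⟨ y , z ⟩?
  ... | yes xy | _      = inj₁ xy
  ... | no  _  | yes yz = inj₂ yz
  ... | no ¬xy | no ¬yz = ⊥-elim (proj₂ (isBipartitional W) ¬xy ¬yz xz)

  ⊆-antisymmetric : ∀ W W′ → W ⊆ W′ → W′ ⊆ W → W ≈ W′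
  ⊆-antisymmetric W W′ = FinitePoset.antisym (bip n) {W} {W′}

  -- Lets later constructions describe a relation by a predicate instead of handling row vectors.
  realize : ∀ {R : Fin n → Fin n → Set} (R? : ∀ x y → Dec (R x y)) →
            (∀ {x y z} → R x y → R y z → R x z) →
            (∀ {x z} y → R x z → R x y ⊎ R y z) →
            ∃ λ W → ∀ x y → W ⟨ x , y ⟩ ⇔ R x y
  realize {R} R? R-trans R-cotrans =
    (table , (λ xy yz → from (spec _ _) (R-trans (to (spec _ _) xy) (to (spec _ _) yz)))
           , (λ {_} {y} ¬xy ¬yz xz → [ ¬xy ∘ from (spec _ _) , ¬yz ∘ from (spec _ _) ]′
               (R-cotrans y (to (spec _ _) xz))))
    , spec
    where
    table : Relation n
    table = tabulate λ x → tabulate λ y → does (R? x y)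

    entry : ∀ x y → Vec.lookup (Vec.lookup table x) y ≡ does (R? x y)
    entry x y = trans (cong (λ row → Vec.lookup row y) (lookup∘tabulate _ x)) (lookup∘tabulate _ y)

    decided : ∀ {A : Set} (d : Dec A) → does d ≡ true → A
    decided (yes a) _ = a

    spec : ∀ x y → (table [ x , y ]) ⇔ R x y
    spec x y = mk⇔
      (λ xy → decided (R? x y) (trans (sym (entry x y)) ([]=⇒lookup xy)))
      (λ r → lookup⇒[]= y _ (trans (entry x y) (dec-true (R? x y) r)))

  strict-witness : ∀ W W′ → W ⊆ W′ → ¬ W ≈ W′ → ∃₂ λ x y → W′ ⟨ x , y ⟩ × ¬ W ⟨ x , y ⟩
  strict-witness W W′ W⊆W′ W≉W′
    with any? (λ x → any? λ y → W′ ⟨ x , y ⟩? ×-dec ¬? (W ⟨ x , y ⟩?))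
  ... | yes p = p
  ... | no ¬p = ⊥-elim (W≉W′ (⊆-antisymmetric W W′ W⊆W′ λ x y xy →
                  decidable-stable (W ⟨ x , y ⟩?) λ ¬xy → ¬p (x , y , xy , ¬xy)))

  open FinitePoset (bip n) using (_⋖_)

  -- Linked W W′ x′ x and Linked W W′ y y′ force (x′ , y′) into every
  -- bipartitional Z between W and W′ that contains (x , y).
  Linked : Bip n → Bip n → Fin n → Fin n → Set
  Linked W W′ p q = p ≡ q ⊎ W ⟨ p , q ⟩ ⊎ ¬ W′ ⟨ q , p ⟩

  -- A Z strictly between would contain some new pair (x , y) and omit some new pair (x′ , y′). The
  -- links carry the first to the second inside Z, by transitivity or, where a link says that W′
  -- lacks a pair, by cotransitivity.
  linked⇒⋖ : ∀ W W′ → W ⊆ W′ → (∃₂ λ x y → W′ ⟨ x , y ⟩ × ¬ W ⟨ x , y ⟩) →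
             (∀ {x y x′ y′} → W′ ⟨ x , y ⟩ → ¬ W ⟨ x , y ⟩ → W′ ⟨ x′ , y′ ⟩ → ¬ W ⟨ x′ , y′ ⟩ →
               Linked W W′ x′ x × Linked W W′ y y′) →
             W ⋖ W′
  linked⇒⋖ W W′ W⊆W′ (x₀ , y₀ , new , ¬old) linked =
    (W⊆W′ , λ W≈W′ → ¬old (subst (_[ x₀ , y₀ ]) (sym W≈W′) new)) , no-between
    where
    no-between : ¬ ∃ λ Z → (W ⊆ Z × ¬ W ≈ Z) × (Z ⊆ W′ × ¬ Z ≈ W′)
    no-between (Z , (W⊆Z , W≉Z) , (Z⊆W′ , Z≉W′))
      with strict-witness W Z W⊆Z W≉Z | strict-witness Z W′ Z⊆W′ Z≉W′
    ... | x , y , Zxy , ¬Wxy | x′ , y′ , W′xy , ¬Zxy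
      with linked (Z⊆W′ _ _ Zxy) ¬Wxy W′xy (¬Zxy ∘ W⊆Z _ _)
    ... | x′~x , y~y′ = ¬Zxy (move-target y~y′ (move-source x′~x))
      where
      move-source : Linked W W′ x′ x → Z ⟨ x′ , y ⟩
      move-source (inj₁ refl)        = Zxy
      move-source (inj₂ (inj₁ x′x))  = transitive Z (W⊆Z _ _ x′x) Zxy
      move-source (inj₂ (inj₂ ¬xx′)) = [ ⊥-elim ∘ ¬xx′ ∘ Z⊆W′ _ _ , id ]′ (cotransitive Z x′ Zxy)

      move-target : Linked W W′ y y′ → Z ⟨ x′ , y ⟩ → Z ⟨ x′ , y′ ⟩
      move-target (inj₁ refl)        x′y = x′y
      move-target (inj₂ (inj₁ yy′))  x′y = transitive Z x′y (W⊆Z _ _ yy′)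
      move-target (inj₂ (inj₂ ¬y′y)) x′y = [ id , ⊥-elim ∘ ¬y′y ∘ Z⊆W′ _ _ ]′ (cotransitive Z y′ x′y)

  Same? : ∀ W x y → Dec (Same (rel W) x y)
  Same? W x y = (W ⟨ x , y ⟩? ×-dec W ⟨ y , x ⟩?) ⊎-dec (¬? (W ⟨ x , y ⟩?) ×-dec ¬? (W ⟨ y , x ⟩?))

  isRegular? : ∀ U W → Dec (IsRegular U W)
  isRegular? U W = all? λ x → W ⟨ x , x ⟩? →-dec ¬? (U ⟨ x , x ⟩?) →-dec
    all? λ y → Same? U x y ⇔-dec Same? W x y

  Same-cong : ∀ W W′ {x y} → W ⟨ x , y ⟩ ⇔ W′ ⟨ x , y ⟩ → W ⟨ y , x ⟩ ⇔ W′ ⟨ y , x ⟩ →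
              Same (rel W) x y → Same (rel W′) x y
  Same-cong W W′ xy yx (inj₁ (p , q)) = inj₁ (to xy p , to yx q)
  Same-cong W W′ xy yx (inj₂ (p , q)) = inj₂ (p ∘ from xy , q ∘ from yx)

  Mid : Bip n → Bip n → Bip n → Set
  Mid U V W = U ⊆ W × W ⊆ V × IsRegular U W

  mid? : ∀ U V W → Dec (Mid U V W)
  mid? U V W = FinitePoset._≤?_ (bip n) U W ×-dec FinitePoset._≤?_ (bip n) W V ×-dec isRegular? U W

module RankSums {n : ℕ} {rk : Bip n → ℕ} (isRank : FinitePoset.IsRankFunction (bip n) rk) where

  open FinitePoset.IsRankFunction isRank
  open Sums (bip n) public
  open SignedSums rk

  cover-parity : ∀ {W W′} → FinitePoset._⋖_ (bip n) W W′ → sign (rk W′) ≡ - sign (rk W)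
  cover-parity {W} {W′} c = trans (cong sign (rank-cover {W} {W′} c)) (sign-suc (rk W))


  -- First matching: merging two consecutive underlined blocks.

  -- The hypotheses say that s and t lie in consecutive underlined blocks of U
  -- which V merges; partners differ in whether these two blocks are merged.
  module MergeUnderlined (U V : Bip n) (s t : Fin n)
    (adjacent : ∀ z → U ⟨ z , s ⟩ ⊎ U ⟨ t , z ⟩) (¬Uts : ¬ U ⟨ t , s ⟩) (Vts : V ⟨ t , s ⟩) where

    -- For W containing U, this W′ is the least transitive relation containing W and (t , s).
    Merges : Bip n → Bip n → Set
    Merges W W′ = ¬ W ⟨ t , s ⟩ × (∀ x y → W′ ⟨ x , y ⟩ ⇔ (W ⟨ x , y ⟩ ⊎ (W ⟨ x , t ⟩ × W ⟨ s , y ⟩)))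

    Uss : U ⟨ s , s ⟩
    Uss = [ id , ⊥-elim ∘ ¬Uts ]′ (adjacent s)

    Utt : U ⟨ t , t ⟩
    Utt = [ ⊥-elim ∘ ¬Uts , id ]′ (adjacent t)

    Ust : U ⟨ s , t ⟩
    Ust = [ id , ⊥-elim ∘ ¬Uts ]′ (cotransitive U t Uss)

    module _ (W : Bip n) (U⊆W : U ⊆ W) where

      adjacent′ : ∀ z → W ⟨ z , s ⟩ ⊎ W ⟨ t , z ⟩
      adjacent′ z = [ inj₁ ∘ U⊆W _ _ , inj₂ ∘ U⊆W _ _ ]′ (adjacent z)

      -- A pair (x , y) added by the merging has (x , t) and (s , y) in W. Together with these, the
      -- two lemmas place x in the W-block of t and y in the W-block of s.
      new-source : ∀ {x y} → ¬ W ⟨ x , y ⟩ → W ⟨ s , y ⟩ → W ⟨ t , x ⟩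
      new-source {x} ¬xy sy = [ (λ xs → ⊥-elim (¬xy (transitive W xs sy))) , id ]′ (adjacent′ x)

      new-target : ∀ {x y} → ¬ W ⟨ x , y ⟩ → W ⟨ x , t ⟩ → W ⟨ y , s ⟩
      new-target {x} {y} ¬xy xt = [ id , (λ ty → ⊥-elim (¬xy (transitive W xt ty))) ]′ (adjacent′ y)

      merge : ∃ λ W′ → ∀ x y → W′ ⟨ x , y ⟩ ⇔ (W ⟨ x , y ⟩ ⊎ (W ⟨ x , t ⟩ × W ⟨ s , y ⟩))
      merge = realize (λ x y → W ⟨ x , y ⟩? ⊎-dec (W ⟨ x , t ⟩? ×-dec W ⟨ s , y ⟩?)) R-trans R-cotrans
        where
        R : Fin n → Fin n → Set
        R x y = W ⟨ x , y ⟩ ⊎ (W ⟨ x , t ⟩ × W ⟨ s , y ⟩)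
        R-trans : ∀ {x y z} → R x y → R y z → R x z
        R-trans (inj₁ xy)        (inj₁ yz)        = inj₁ (transitive W xy yz)
        R-trans (inj₁ xy)        (inj₂ (yt , sz)) = inj₂ (transitive W xy yt , sz)
        R-trans (inj₂ (xt , sy)) (inj₁ yz)        = inj₂ (xt , transitive W sy yz)
        R-trans (inj₂ (xt , _))  (inj₂ (_ , sz))  = inj₂ (xt , sz)
        R-cotrans : ∀ {x z} y → R x z → R x y ⊎ R y z
        R-cotrans y (inj₁ xz) = [ inj₁ ∘ inj₁ , inj₂ ∘ inj₁ ]′ (cotransitive W y xz)
        -- Since (s , t) lies in W, cotransitivity through y gives either (s , y) or (y , t).
        R-cotrans y (inj₂ (xt , sz)) =
          [ (λ sy → inj₁ (inj₂ (xt , sy))) , (λ yt → inj₂ (inj₂ (yt , sz))) ]′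
          (cotransitive W y (U⊆W _ _ Ust))

      -- Inverse of merging: inside a block of W, the elements z with (z , s) in U are placed before
      -- the others, by dropping the pairs that lead from the others back to them.
      cut : ∃ λ W₁ → ∀ x y → W₁ ⟨ x , y ⟩ ⇔
              (W ⟨ x , y ⟩ × (W ⟨ y , x ⟩ → U ⟨ y , s ⟩ → U ⟨ x , s ⟩))
      cut = realize (λ x y → W ⟨ x , y ⟩? ×-dec (W ⟨ y , x ⟩? →-dec U ⟨ y , s ⟩? →-dec U ⟨ x , s ⟩?))
        (λ { (xy , f) (yz , g) → transitive W xy yz , λ zx zs →
             f (transitive W yz zx) (g (transitive W zx xy) zs) })
        R-cotrans
        where
        R : Fin n → Fin n → Set
        R x y = W ⟨ x , y ⟩ × (W ⟨ y , x ⟩ → U ⟨ y , s ⟩ → U ⟨ x , s ⟩)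
        R-cotrans : ∀ {x z} y → R x z → R x y ⊎ R y z
        R-cotrans {x} {z} y (xz , f) with W ⟨ x , y ⟩? | W ⟨ y , z ⟩? | W ⟨ z , x ⟩?
        ... | no ¬xy | no ¬yz | _ = ⊥-elim ([ ¬xy , ¬yz ]′ (cotransitive W y xz))
        ... | no ¬xy | yes yz | _ = inj₂ (yz , λ zy → ⊥-elim (¬xy (transitive W xz zy)))
        ... | yes xy | no ¬yz | _ = inj₁ (xy , λ yx → ⊥-elim (¬yz (transitive W yx xz)))
        ... | yes xy | yes yz | no ¬zx with W ⟨ y , x ⟩?
        ...   | no ¬yx = inj₁ (xy , ⊥-elim ∘ ¬yx)
        ...   | yes yx = inj₂ (yz , λ zy → ⊥-elim (¬zx (transitive W zy yx)))
        R-cotrans {x} {z} y (xz , f) | yes xy | yes yz | yes zx with U ⟨ y , s ⟩?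
        ...   | yes ys = inj₂ (yz , λ _ _ → ys)
        ...   | no ¬ys = inj₁ (xy , λ _ → ⊥-elim ∘ ¬ys)

    -- The right-hand side is the formula of `cut` and mentions only W, so the lower partner is
    -- determined by the upper one.
    merges-lower : ∀ {W₁ W} → U ⊆ W₁ → Merges W₁ W → ∀ x y → W₁ ⟨ x , y ⟩ ⇔
                   (W ⟨ x , y ⟩ × (W ⟨ y , x ⟩ → U ⟨ y , s ⟩ → U ⟨ x , s ⟩))
    merges-lower {W₁} {W} U⊆W₁ (¬ts , W-spec) x y = mk⇔ ⇒ ⇐
      where
      ⇒ : W₁ ⟨ x , y ⟩ → W ⟨ x , y ⟩ × (W ⟨ y , x ⟩ → U ⟨ y , s ⟩ → U ⟨ x , s ⟩)
      ⇒ xy = from (W-spec x y) (inj₁ xy) , λ _ ys → [ id , (λ tx → ⊥-elim (¬ts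
        (transitive W₁ (U⊆W₁ _ _ tx) (transitive W₁ xy (U⊆W₁ _ _ ys))))) ]′ (adjacent x)
      ⇐ : W ⟨ x , y ⟩ × (W ⟨ y , x ⟩ → U ⟨ y , s ⟩ → U ⟨ x , s ⟩) → W₁ ⟨ x , y ⟩
      ⇐ (xy , f) with to (W-spec x y) xy
      ... | inj₁ xy₁ = xy₁
      ... | inj₂ (xt , sy) = decidable-stable (W₁ ⟨ x , y ⟩?) λ ¬xy₁ →
        [ (λ ys → ¬xy₁ (transitive W₁ (U⊆W₁ _ _ (f (yx ¬xy₁) ys)) sy))
        , (λ ty → ¬xy₁ (transitive W₁ xt (U⊆W₁ _ _ ty))) ]′ (adjacent y)
        where
        yx : ¬ W₁ ⟨ x , y ⟩ → W ⟨ y , x ⟩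
        yx ¬xy₁ = from (W-spec y x) (inj₁ (transitive W₁ (new-target W₁ U⊆W₁ ¬xy₁ xt)
          (transitive W₁ (U⊆W₁ _ _ Ust) (new-source W₁ U⊆W₁ ¬xy₁ sy))))

    merge-mid : ∀ {W W′} → Mid U V W → Merges W W′ → Mid U V W′
    merge-mid {W} {W′} (U⊆W , W⊆V , regular) (¬ts , W′-spec) = (λ x y → old ∘ U⊆W x y) , W′⊆V , regular′
      where
      old : ∀ {x y} → W ⟨ x , y ⟩ → W′ ⟨ x , y ⟩
      old = from (W′-spec _ _) ∘ inj₁

      W′⊆V : W′ ⊆ V
      W′⊆V x y xy with to (W′-spec x y) xy
      ... | inj₁ p = W⊆V x y p
      ... | inj₂ (xt , sy) = transitive V (W⊆V _ _ xt) (transitive V Vts (W⊆V _ _ sy))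

      regular′ : IsRegular U W′
      regular′ x xx ¬Uxx y = mk⇔
        (Same-cong W W′ (same xy⇒) (same yx⇒) ∘ to (regular x Wxx ¬Uxx y))
        (from (regular x Wxx ¬Uxx y) ∘ Same-cong W′ W (flipped xy⇒) (flipped yx⇒))
        where
        Wxx : W ⟨ x , x ⟩
        Wxx = decidable-stable (W ⟨ x , x ⟩?) λ ¬xx → [ ¬xx , (λ { (xt , sx) →
          ¬ts (transitive W (new-source W U⊆W ¬xx sx) (new-target W U⊆W ¬xx xt)) }) ]′ (to (W′-spec x x) xx)
        -- By regularity, sharing a W-block with s would mean sharing a U-block with s, which is
        -- underlined in U although x is not. The same holds for t, so x lies in neither merged
        -- block and its row and column do not change.
        apart-s : ¬ (W ⟨ x , s ⟩ × W ⟨ s , x ⟩)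
        apart-s both = ¬Uxx (case-same (from (regular x Wxx ¬Uxx s) (inj₁ both)))
          where
          case-same : Same (rel U) x s → U ⟨ x , x ⟩
          case-same (inj₁ (xs , sx)) = transitive U xs sx
          case-same (inj₂ (¬xs , ¬sx)) = ⊥-elim ([ ¬sx , ¬xs ]′ (cotransitive U x Uss))
        apart-t : ¬ (W ⟨ x , t ⟩ × W ⟨ t , x ⟩)
        apart-t both = ¬Uxx (case-same (from (regular x Wxx ¬Uxx t) (inj₁ both)))
          where
          case-same : Same (rel U) x t → U ⟨ x , x ⟩
          case-same (inj₁ (xt , tx)) = transitive U xt tx
          case-same (inj₂ (¬xt , ¬tx)) = ⊥-elim ([ ¬tx , ¬xt ]′ (cotransitive U x Utt))
        xy⇒ : W′ ⟨ x , y ⟩ → W ⟨ x , y ⟩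
        xy⇒ p with to (W′-spec x y) p
        ... | inj₁ q = q
        ... | inj₂ (xt , sy) = decidable-stable (W ⟨ x , y ⟩?) λ ¬xy →
          apart-t (xt , new-source W U⊆W ¬xy sy)
        yx⇒ : W′ ⟨ y , x ⟩ → W ⟨ y , x ⟩
        yx⇒ p with to (W′-spec y x) p
        ... | inj₁ q = q
        ... | inj₂ (yt , sx) = decidable-stable (W ⟨ y , x ⟩?) λ ¬yx →
          apart-s (new-target W U⊆W ¬yx yt , sx)
        same : ∀ {a b} → (W′ ⟨ a , b ⟩ → W ⟨ a , b ⟩) → W ⟨ a , b ⟩ ⇔ W′ ⟨ a , b ⟩
        same f = mk⇔ old f
        flipped : ∀ {a b} → (W′ ⟨ a , b ⟩ → W ⟨ a , b ⟩) → W′ ⟨ a , b ⟩ ⇔ W ⟨ a , b ⟩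
        flipped f = mk⇔ f old

    cut-partner : ∀ {W} → Mid U V W → W ⟨ t , s ⟩ → ∃ λ W₁ → Mid U V W₁ × Merges W₁ W
    cut-partner {W} (U⊆W , W⊆V , regular) ts with cut W U⊆W
    ... | W₁ , spec = W₁ , (U⊆W₁ , (λ x y → W⊆V x y ∘ old) , regular₁) , ¬ts₁ , λ x y → mk⇔ (⇒ x y) ⇐
      where
      old : ∀ {x y} → W₁ ⟨ x , y ⟩ → W ⟨ x , y ⟩
      old = proj₁ ∘ to (spec _ _)
      U⊆W₁ : U ⊆ W₁
      U⊆W₁ x y xy = from (spec x y) (U⊆W x y xy , λ _ → transitive U xy)
      regular₁ : IsRegular U W₁
      regular₁ x xx ¬Uxx y = mk⇔ (up ∘ to (regular x (old xx) ¬Uxx y))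
        (from (regular x (old xx) ¬Uxx y) ∘ down)
        where
        up : Same (rel W) x y → Same (rel W₁) x y
        up (inj₂ (¬xy , ¬yx)) = inj₂ (¬xy ∘ old , ¬yx ∘ old)
        up (inj₁ (xy , yx)) with from (regular x (old xx) ¬Uxx y) (inj₁ (xy , yx))
        ... | inj₁ (Uxy , Uyx) = ⊥-elim (¬Uxx (transitive U Uxy Uyx))
        -- Here x and y are in one nonunderlined block of U, so they stand in the same relation to s
        -- and the cut keeps them together.
        ... | inj₂ (¬Uxy , ¬Uyx) = inj₁
          ( from (spec x y) (xy , λ _ ys → [ ⊥-elim ∘ ¬Uyx , id ]′ (cotransitive U x ys))
          , from (spec y x) (yx , λ _ xs → [ ⊥-elim ∘ ¬Uxy , id ]′ (cotransitive U y xs)) )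
        down : Same (rel W₁) x y → Same (rel W) x y
        down (inj₁ (xy , yx)) = inj₁ (old xy , old yx)
        down (inj₂ (¬xy , ¬yx)) = ⊥-elim ([ ¬xy , ¬yx ]′ (cotransitive W₁ y xx))
      ¬ts₁ : ¬ W₁ ⟨ t , s ⟩
      ¬ts₁ p = ¬Uts (proj₂ (to (spec t s) p) (U⊆W _ _ Ust) Uss)
      ⇐ : ∀ {x y} → W₁ ⟨ x , y ⟩ ⊎ (W₁ ⟨ x , t ⟩ × W₁ ⟨ s , y ⟩) → W ⟨ x , y ⟩
      ⇐ (inj₁ xy) = old xy
      ⇐ (inj₂ (xt , sy)) = transitive W (old xt) (transitive W ts (old sy))
      ⇒ : ∀ x y → W ⟨ x , y ⟩ → W₁ ⟨ x , y ⟩ ⊎ (W₁ ⟨ x , t ⟩ × W₁ ⟨ s , y ⟩)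
      ⇒ x y xy with W ⟨ y , x ⟩? | U ⟨ y , s ⟩? | U ⟨ x , s ⟩?
      ... | no ¬yx | _      | _      = inj₁ (from (spec x y) (xy , ⊥-elim ∘ ¬yx))
      ... | yes _  | no ¬ys | _      = inj₁ (from (spec x y) (xy , λ _ → ⊥-elim ∘ ¬ys))
      ... | yes _  | yes _  | yes xs = inj₁ (from (spec x y) (xy , λ _ _ → xs))
      -- A dropped pair is recovered by the detour from x to t and from s to y.
      ... | yes _  | yes ys | no ¬xs = inj₂
        ( from (spec x t) (transitive W xy (transitive W (U⊆W _ _ ys) (U⊆W _ _ Ust)) , λ _ → ⊥-elim ∘ ¬Uts)
        , from (spec s y) (transitive W (U⊆W _ _ Ust) (transitive W (U⊆W _ _ Utx) xy) , λ _ _ → Uss) )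
        where
        Utx : U ⟨ t , x ⟩
        Utx = [ ⊥-elim ∘ ¬xs , id ]′ (adjacent x)

    -- All new pairs lead from the W-block of t to the W-block of s. Both blocks are underlined in
    -- W, so any two sources and any two targets are linked.
    merges-⋖ : ∀ {W W′} → U ⊆ W → Merges W W′ → FinitePoset._⋖_ (bip n) W W′
    merges-⋖ {W} {W′} U⊆W (¬ts , spec) = linked⇒⋖ W W′ (λ x y → from (spec x y) ∘ inj₁)
      (t , s , from (spec t s) (inj₂ (U⊆W _ _ Utt , U⊆W _ _ Uss)) , ¬ts)
      linked
      where
      linked : ∀ {x y x′ y′} → W′ ⟨ x , y ⟩ → ¬ W ⟨ x , y ⟩ → W′ ⟨ x′ , y′ ⟩ → ¬ W ⟨ x′ , y′ ⟩ →
               Linked W W′ x′ x × Linked W W′ y y′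
      linked xy ¬xy xy′ ¬xy′ with to (spec _ _) xy | to (spec _ _) xy′
      ... | inj₁ p | _ = ⊥-elim (¬xy p)
      ... | inj₂ _ | inj₁ p = ⊥-elim (¬xy′ p)
      ... | inj₂ (xt , sy) | inj₂ (x′t , sy′) =
        inj₂ (inj₁ (transitive W x′t (new-source W U⊆W ¬xy sy))) ,
        inj₂ (inj₁ (transitive W (new-target W U⊆W ¬xy xt) sy′))

    pairing : Pairing (Mid U V) Merges rk
    pairing = record
      { P-resp  = λ { {_ , _} {_ , _} refl p → p }
      ; N-respˡ = λ { {_ , _} {_ , _} refl p → p }
      ; N-respʳ = λ { {_} {_ , _} {_ , _} refl p → p }
      ; partner = λ {W} → partner {W}
      ; upper-unique = λ {x} {y} {y′} _ _ _ (_ , spec) (_ , spec′) → ⊆-antisymmetric y y′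
          (λ a b → from (spec′ a b) ∘ to (spec a b)) (λ a b → from (spec a b) ∘ to (spec′ a b))
      ; lower-unique = λ {x} {x′} {y} p p′ _ N N′ →
          let spec  = merges-lower {x} {y} (proj₁ p) N
              spec′ = merges-lower {x′} {y} (proj₁ p′) N′
          in ⊆-antisymmetric x x′
          (λ a b → from (spec′ a b) ∘ to (spec a b)) (λ a b → from (spec a b) ∘ to (spec′ a b))
      ; lower≢upper = λ (U⊆W , _) _ _ (_ , spec) (¬ts , _) →
          ¬ts (from (spec t s) (inj₂ (U⊆W _ _ Utt , U⊆W _ _ Uss)))
      ; parity = λ {x} {y} (U⊆W , _) _ N → cover-parity {x} {y} (merges-⋖ {x} {y} U⊆W N)
      }
      where
      partner : ∀ {W} → Mid U V W → ∃ λ W′ → Mid U V W′ × (Merges W W′ ⊎ Merges W′ W)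
      partner {W} mid with W ⟨ t , s ⟩?
      ... | yes ts = let W₁ , mid₁ , N = cut-partner {W} mid ts in W₁ , mid₁ , inj₂ N
      ... | no ¬ts = let W′ , spec = merge W (proj₁ mid) in
                     W′ , merge-mid {W} {W′} mid (¬ts , spec) , inj₁ (¬ts , spec)

    vanishes : signedSum (mid? U V) ≡ 0ℤ
    vanishes = pairing⇒0 (mid? U V) pairing

  -- Rearranging a nonunderlined block of U.

  module NonunderlinedClass (U V : Bip n) (o : Fin n) (¬Uoo : ¬ U ⟨ o , o ⟩) where

    -- The ∼-class of `o` in U: having both (o , x) and (x , o) in U would give (o , o).
    B : Fin n → Set
    B x = ¬ U ⟨ o , x ⟩ × ¬ U ⟨ x , o ⟩

    B? : ∀ x → Dec (B x)
    B? x = ¬? (U ⟨ o , x ⟩?) ×-dec ¬? (U ⟨ x , o ⟩?)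

    o∈B : B o
    o∈B = ¬Uoo , ¬Uoo

    B² : Fin n → Fin n → Set
    B² x y = B x × B y

    B²? : ∀ x y → Dec (B² x y)
    B²? x y = B? x ×-dec B? y

    U-empty : ∀ {b b′} → B b → B b′ → ¬ U ⟨ b , b′ ⟩
    U-empty (_ , ¬bo) (¬ob′ , _) bb′ = [ ¬bo , ¬ob′ ]′ (cotransitive U o bb′)

    U-comparable : ∀ {z b} → ¬ B z → B b → U ⟨ z , b ⟩ ⊎ U ⟨ b , z ⟩
    U-comparable {z} {b} z∉B (¬ob , ¬bo) with U ⟨ z , o ⟩? | U ⟨ o , z ⟩?
    ... | yes zo | _      = inj₁ ([ id , ⊥-elim ∘ ¬bo ]′ (cotransitive U b zo))
    ... | no _   | yes oz = inj₂ ([ ⊥-elim ∘ ¬ob , id ]′ (cotransitive U b oz))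
    ... | no ¬zo | no ¬oz = ⊥-elim (z∉B (¬oz , ¬zo))

    AgreeOutside : Bip n → Bip n → Set
    AgreeOutside W W′ = ∀ x y → ¬ B² x y → W ⟨ x , y ⟩ ⇔ W′ ⟨ x , y ⟩

    agree-sym : ∀ {W W′} → AgreeOutside W W′ → AgreeOutside W′ W
    agree-sym agree x y ∉B = mk⇔ (from (agree x y ∉B)) (to (agree x y ∉B))

    module Regular (W : Bip n) (U⊆W : U ⊆ W) (regular : IsRegular U W) where

      -- Both pairs together would give b a loop in W that it lacks in U; regularity then puts z in
      -- the U-class of b, which is B.
      asymmetric : ∀ {z b} → ¬ B z → B b → W ⟨ z , b ⟩ → ¬ W ⟨ b , z ⟩
      asymmetric {z} {b} z∉B b∈B zb bz
        with from (regular b (transitive W bz zb) (U-empty b∈B b∈B) z) (inj₁ (bz , zb))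
      ... | inj₁ (Ubz , Uzb) = U-empty b∈B b∈B (transitive U Ubz Uzb)
      ... | inj₂ (¬bz , ¬zb) = [ ¬zb , ¬bz ]′ (U-comparable z∉B b∈B)

      comparable : ∀ {z b} → ¬ B z → B b → W ⟨ z , b ⟩ ⊎ W ⟨ b , z ⟩
      comparable z∉B b∈B = [ inj₁ ∘ U⊆W _ _ , inj₂ ∘ U⊆W _ _ ]′ (U-comparable z∉B b∈B)

      U-below : ∀ {z b} → ¬ B z → B b → W ⟨ z , b ⟩ → U ⟨ z , b ⟩
      U-below z∉B b∈B zb =
        [ id , (λ bz → ⊥-elim (asymmetric z∉B b∈B zb (U⊆W _ _ bz))) ]′ (U-comparable z∉B b∈B)

      U-above : ∀ {z b} → ¬ B z → B b → W ⟨ b , z ⟩ → U ⟨ b , z ⟩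
      U-above z∉B b∈B bz =
        [ (λ zb → ⊥-elim (asymmetric z∉B b∈B (U⊆W _ _ zb) bz)) , id ]′ (U-comparable z∉B b∈B)

      -- Between B and its complement W agrees with U, and U does not distinguish the members of its
      -- class B.
      homogeneousˡ : ∀ {z b b′} → ¬ B z → B b → B b′ → W ⟨ z , b ⟩ → W ⟨ z , b′ ⟩
      homogeneousˡ {b′ = b′} z∉B b∈B b′∈B zb =
        [ U⊆W _ _ , ⊥-elim ∘ U-empty b′∈B b∈B ]′ (cotransitive U b′ (U-below z∉B b∈B zb))

      homogeneousʳ : ∀ {z b b′} → ¬ B z → B b → B b′ → W ⟨ b , z ⟩ → W ⟨ b′ , z ⟩
      homogeneousʳ {b′ = b′} z∉B b∈B b′∈B bz =
        [ ⊥-elim ∘ U-empty b∈B b′∈B , U⊆W _ _ ]′ (cotransitive U b′ (U-above z∉B b∈B bz))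

      apart : ∀ {b z} → ¬ B z → B b → ¬ Same (rel W) b z
      apart z∉B b∈B (inj₁ (bz , zb))   = asymmetric z∉B b∈B zb bz
      apart z∉B b∈B (inj₂ (¬bz , ¬zb)) = [ ¬zb , ¬bz ]′ (comparable z∉B b∈B)

      -- Together with `full`: a loop at any element of B is new over U, so by regularity its
      -- W-class is all of B. Hence B is underlined as a whole or not at all.
      loopless : ¬ W ⟨ o , o ⟩ → ∀ {b} → B b → ¬ W ⟨ b , b ⟩
      loopless ¬oo {b} b∈B bb with to (regular b bb (U-empty b∈B b∈B) o)
        (inj₂ (U-empty b∈B o∈B , U-empty o∈B b∈B))
      ... | inj₁ (bo , ob)   = ¬oo (transitive W ob bo)
      ... | inj₂ (¬bo , ¬ob) = [ ¬bo , ¬ob ]′ (cotransitive W o bb)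

      full : W ⟨ o , o ⟩ → ∀ {b b′} → B b → B b′ → W ⟨ b , b′ ⟩
      full oo {b} {b′} b∈B b′∈B = transitive W (proj₂ (with-o b∈B)) (proj₁ (with-o b′∈B))
        where
        with-o : ∀ {b} → B b → W ⟨ o , b ⟩ × W ⟨ b , o ⟩
        with-o {b} b∈B with to (regular o oo ¬Uoo b) (inj₂ (U-empty o∈B b∈B , U-empty b∈B o∈B))
        ... | inj₁ both        = both
        ... | inj₂ (¬ob , ¬bo) = ⊥-elim ([ ¬ob , ¬bo ]′ (cotransitive W b oo))

      -- Elements outside B cannot tell its members apart, so the restriction of W to B may be
      -- exchanged for that of any transitive and cotransitive Q.
      module Replacement {Q : Fin n → Fin n → Set} (Q? : ∀ x y → Dec (Q x y))
        (Q-trans : ∀ {x y z} → Q x y → Q y z → Q x z)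
        (Q-cotrans : ∀ {x z} y → Q x z → Q x y ⊎ Q y z) where

        R : Fin n → Fin n → Set
        R x y = (B² x y × Q x y) ⊎ (¬ B² x y × W ⟨ x , y ⟩)

        replaced : ∃ λ W′ → ∀ x y → W′ ⟨ x , y ⟩ ⇔ R x y
        replaced = realize
          (λ x y → (B²? x y ×-dec Q? x y) ⊎-dec (¬? (B²? x y) ×-dec W ⟨ x , y ⟩?)) R-trans R-cotrans
          where
          R-trans : ∀ {x y z} → R x y → R y z → R x z
          R-trans (inj₁ ((x∈B , y∈B) , xy)) (inj₁ ((_ , z∈B) , yz)) = inj₁ ((x∈B , z∈B) , Q-trans xy yz)
          R-trans (inj₁ ((x∈B , y∈B) , _))  (inj₂ (∉B , yz)) =
            inj₂ ((λ (_ , z∈B) → ∉B (y∈B , z∈B)) , homogeneousʳ (λ z∈B → ∉B (y∈B , z∈B)) y∈B x∈B yz)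
          R-trans (inj₂ (∉B , xy)) (inj₁ ((y∈B , z∈B) , _)) =
            inj₂ ((λ (x∈B , _) → ∉B (x∈B , y∈B)) , homogeneousˡ (λ x∈B → ∉B (x∈B , y∈B)) y∈B z∈B xy)
          -- If x and z were both in B, then y would be outside, and homogeneity would relate y and
          -- z both ways.
          R-trans {x} {y} {z} (inj₂ (∉B , xy)) (inj₂ (_ , yz)) = inj₂
            ( (λ (x∈B , z∈B) → asymmetric (λ y∈B → ∉B (x∈B , y∈B)) z∈B yz
                 (homogeneousʳ (λ y∈B → ∉B (x∈B , y∈B)) x∈B z∈B xy))
            , transitive W xy yz)

          R-cotrans : ∀ {x z} y → R x z → R x y ⊎ R y z
          R-cotrans y (inj₁ ((x∈B , z∈B) , xz)) with B? y
          ... | yes y∈B = [ (λ q → inj₁ (inj₁ ((x∈B , y∈B) , q))) , (λ q → inj₂ (inj₁ ((y∈B , z∈B) , q))) ]′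
                            (Q-cotrans y xz)
          ... | no  y∉B = [ (λ yz → inj₂ (inj₂ (y∉B ∘ proj₁ , yz)))
                          , (λ zy → inj₁ (inj₂ (y∉B ∘ proj₂ , homogeneousʳ y∉B z∈B x∈B zy))) ]′
                            (comparable y∉B z∈B)
          R-cotrans {x} {z} y (inj₂ (∉B , xz)) with B²? x y | B²? y z
          ... | yes (x∈B , y∈B) | _ =
            inj₂ (inj₂ ((λ (_ , z∈B) → ∉B (x∈B , z∈B)) , homogeneousʳ (λ z∈B → ∉B (x∈B , z∈B)) x∈B y∈B xz))
          ... | no _ | yes (y∈B , z∈B) =
            inj₁ (inj₂ ((λ (x∈B , _) → ∉B (x∈B , z∈B)) , homogeneousˡ (λ x∈B → ∉B (x∈B , z∈B)) z∈B y∈B xz))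
          ... | no ∉xy | no ∉yz =
            [ (λ xy → inj₁ (inj₂ (∉xy , xy))) , (λ yz → inj₂ (inj₂ (∉yz , yz))) ]′ (cotransitive W y xz)

        replaced-agrees : AgreeOutside W (proj₁ replaced)
        replaced-agrees x y ∉B = mk⇔ (λ xy → from (proj₂ replaced x y) (inj₂ (∉B , xy)))
          (λ xy → [ ⊥-elim ∘ ∉B ∘ proj₁ , proj₂ ]′ (to (proj₂ replaced x y) xy))

        replaced-inside : ∀ {x y} → B x → B y → proj₁ replaced ⟨ x , y ⟩ ⇔ Q x y
        replaced-inside x∈B y∈B = mk⇔
          (λ xy → [ proj₂ , (λ (∉B , _) → ⊥-elim (∉B (x∈B , y∈B))) ]′ (to (proj₂ replaced _ _) xy))
          (λ q → from (proj₂ replaced _ _) (inj₁ ((x∈B , y∈B) , q)))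

    -- Outside B everything is inherited from W. At an element of B, the last hypothesis lets a loop
    -- occur only if all of the U-class B is underlined, as regularity demands.
    mid-transfer : ∀ {W W′} → Mid U V W → AgreeOutside W W′ →
      (∀ {x y} → B x → B y → W′ ⟨ x , y ⟩ → V ⟨ x , y ⟩) →
      (∀ {b} → B b → W′ ⟨ b , b ⟩ → ∀ {x y} → B x → B y → W′ ⟨ x , y ⟩) → Mid U V W′
    mid-transfer {W} {W′} (U⊆W , W⊆V , regular) agree inside full =
      (λ x y xy → to (agree x y λ (x∈B , y∈B) → U-empty x∈B y∈B xy) (U⊆W x y xy)) , W′⊆V , regular′
      where
      W′⊆V : W′ ⊆ V
      W′⊆V x y xy with B²? x y
      ... | yes (x∈B , y∈B) = inside x∈B y∈B xy
      ... | no ∉B = W⊆V x y (from (agree x y ∉B) xy)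

      regular′ : IsRegular U W′
      regular′ x xx ¬Uxx y with B? x | B? y
      ... | yes x∈B | yes y∈B = mk⇔
        (λ _ → inj₁ (full x∈B xx x∈B y∈B , full x∈B xx y∈B x∈B))
        (λ _ → inj₂ (U-empty x∈B y∈B , U-empty y∈B x∈B))
      ... | yes x∈B | no y∉B = mk⇔
        -- The interval from U to U is trivially regular, so `apart` applies to U itself.
        (⊥-elim ∘ Regular.apart U (λ _ _ → id) (λ _ p ¬p → ⊥-elim (¬p p)) y∉B x∈B)
        (⊥-elim ∘ Regular.apart W U⊆W regular y∉B x∈B ∘
          Same-cong W′ W (agree-sym {W} {W′} agree x y (y∉B ∘ proj₂))
            (agree-sym {W} {W′} agree y x (y∉B ∘ proj₁)))
      ... | no x∉B | _ = mk⇔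
        (Same-cong W W′ (agree x y (x∉B ∘ proj₁)) (agree y x (x∉B ∘ proj₂)) ∘ to (regular x Wxx ¬Uxx y))
        (from (regular x Wxx ¬Uxx y) ∘
          Same-cong W′ W (agree-sym {W} {W′} agree x y (x∉B ∘ proj₁))
            (agree-sym {W} {W′} agree y x (x∉B ∘ proj₂)))
        where
        Wxx : W ⟨ x , x ⟩
        Wxx = from (agree x x (x∉B ∘ proj₁)) xx

    -- The witness makes the step proper. For a W that never puts T before S, adding all of S × T
    -- breaks up just the block meeting both.
    Splits : (S T : Fin n → Set) → Bip n → Bip n → Set
    Splits S T W W′ = (∃₂ λ s t → S s × T t × ¬ W ⟨ s , t ⟩) ×
                      (∀ x y → W′ ⟨ x , y ⟩ ⇔ (W ⟨ x , y ⟩ ⊎ (S x × T y)))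

    Rest : (Relation n → Fin n → Set) → Relation n → Fin n → Set
    Rest S R x = B x × ¬ S R x

    -- The extra condition `E` takes the bare relation, so that it respects `_≈_`, which disregards
    -- the transitivity proofs.
    Cell : (Relation n → Set) → Bip n → Set
    Cell E W = Mid U V W × ¬ W ⟨ o , o ⟩ × E (rel W)

    -- While o is not underlined, the restriction of W to B is an ordered
    -- partition.  If it is compatible with S before T, toggling whether the last
    -- block meeting S and the first block meeting T are one block is a matching.
    -- S may depend on W provided toggling leaves it unchanged.
    module Toggle (S : Relation n → Fin n → Set) (S? : ∀ R x → Dec (S R x)) (E : Relation n → Set)
      (S⊆B : ∀ {R x} → S R x → B x)
      (T≮S : ∀ W → Cell E W → ∀ {s t} → S (rel W) s → Rest S (rel W) t → ¬ W ⟨ t , s ⟩)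
      (S×T⊆V : ∀ W → Cell E W → ∀ {s t} → S (rel W) s → Rest S (rel W) t → V ⟨ s , t ⟩)
      (S-inhabited : ∀ W → Cell E W → ∃ (S (rel W)))
      (T-inhabited : ∀ W → Cell E W → ∃ (Rest S (rel W)))
      (stable↑ : ∀ W W′ → Cell E W → Splits (S (rel W)) (Rest S (rel W)) W W′ →
                 E (rel W′) × (∀ x → S (rel W) x ⇔ S (rel W′) x))
      (stable↓ : ∀ W W′ → Cell E W′ → Splits (S (rel W′)) (Rest S (rel W′)) W W′ →
                 E (rel W) × (∀ x → S (rel W′) x ⇔ S (rel W) x))
      where

      T : Relation n → Fin n → Set
      T = Rest S

      T? : ∀ R x → Dec (T R x)
      T? R x = B? x ×-dec ¬? (S? R x)

      S⊎T : ∀ R {x} → B x → S R x ⊎ T R x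
      S⊎T R {x} x∈B with S? R x
      ... | yes s = inj₁ s
      ... | no ¬s = inj₂ (x∈B , ¬s)

      splits-agree : ∀ {R W W′} → Splits (S R) (T R) W W′ → AgreeOutside W W′
      splits-agree (_ , spec) x y ∉B = mk⇔ (from (spec x y) ∘ inj₁)
        (λ xy → [ id , (λ (sx , ty) → ⊥-elim (∉B (S⊆B sx , proj₁ ty))) ]′ (to (spec x y) xy))

      splits-cong : ∀ {R R′ W W′} → (∀ x → S R x ⇔ S R′ x) →
                    Splits (S R) (T R) W W′ → Splits (S R′) (T R′) W W′
      splits-cong S≗ ((s , t , s∈S , (t∈B , t∉S) , ¬st) , spec) =
        (s , t , to (S≗ s) s∈S , (t∈B , t∉S ∘ from (S≗ t)) , ¬st) , λ x y → mk⇔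
          (λ xy → [ inj₁ , (λ (sx , ty , ¬sy) → inj₂ (to (S≗ x) sx , ty , ¬sy ∘ from (S≗ y))) ]′ (to (spec x y) xy))
          (λ { (inj₁ xy) → from (spec x y) (inj₁ xy)
             ; (inj₂ (sx , ty , ¬sy)) → from (spec x y) (inj₂ (from (S≗ x) sx , ty , ¬sy ∘ to (S≗ y))) })

      splits-disjoint : ∀ {R W W′ x} → Splits (S R) (T R) W W′ → W′ ⟨ x , x ⟩ → W ⟨ x , x ⟩
      splits-disjoint (_ , spec) xx = [ id , (λ (sx , _ , ¬sx) → ⊥-elim (¬sx sx)) ]′ (to (spec _ _) xx)

      cell↑ : ∀ W W′ → Cell E W → Splits (S (rel W)) (T (rel W)) W W′ → Cell E W′
      cell↑ W W′ c@(mid@(U⊆W , W⊆V , regular) , ¬oo , e) N =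
        mid-transfer {W} {W′} mid (splits-agree {rel W} {W} {W′} N)
          (λ {x} {y} _ _ xy → [ W⊆V x y , (λ (sx , ty) → S×T⊆V W c sx ty) ]′ (to (proj₂ N x y) xy))
          (λ b∈B bb → ⊥-elim (loopless ¬oo b∈B (splits-disjoint {rel W} {W} {W′} N bb))) ,
        ¬oo ∘ splits-disjoint {rel W} {W} {W′} N ,
        proj₁ (stable↑ W W′ c N)
        where open Regular W U⊆W regular

      cell↓ : ∀ W W′ → Cell E W′ → Splits (S (rel W′)) (T (rel W′)) W W′ → Cell E W
      cell↓ W W′ c@(mid@(U⊆W′ , W′⊆V , regular) , ¬oo , e) N =
        mid-transfer {W′} {W} mid (agree-sym {W} {W′} (splits-agree {rel W′} {W} {W′} N))
          (λ {x} {y} _ _ xy → W′⊆V x y (from (proj₂ N x y) (inj₁ xy)))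
          (λ b∈B bb → ⊥-elim (loopless ¬oo b∈B (from (proj₂ N _ _) (inj₁ bb)))) ,
        (λ oo → ¬oo (from (proj₂ N _ _) (inj₁ oo))) ,
        proj₁ (stable↓ W W′ c N)
        where open Regular W′ U⊆W′ regular

      module _ (W : Bip n) (c : Cell E W) where
        open Regular W (proj₁ (proj₁ c)) (proj₂ (proj₂ (proj₁ c)))

        private
          Sᵂ Tᵂ : Fin n → Set
          Sᵂ = S (rel W)
          Tᵂ = T (rel W)

        split : ∃ λ W′ → ∀ x y → W′ ⟨ x , y ⟩ ⇔ (W ⟨ x , y ⟩ ⊎ (Sᵂ x × Tᵂ y))
        split = realize (λ x y → W ⟨ x , y ⟩? ⊎-dec (S? (rel W) x ×-dec T? (rel W) y)) R-trans R-cotrans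
          where
          R : Fin n → Fin n → Set
          R x y = W ⟨ x , y ⟩ ⊎ (Sᵂ x × Tᵂ y)
          R-trans : ∀ {x y z} → R x y → R y z → R x z
          R-trans (inj₁ xy) (inj₁ yz) = inj₁ (transitive W xy yz)
          R-trans {x} (inj₁ xy) (inj₂ (sy , tz)) with B? x
          ... | no x∉B = inj₁ (homogeneousˡ x∉B (S⊆B sy) (proj₁ tz) xy)
          ... | yes x∈B = [ (λ sx → inj₂ (sx , tz)) , (λ tx → ⊥-elim (T≮S W c sy tx xy)) ]′
                            (S⊎T (rel W) x∈B)
          R-trans {z = z} (inj₂ (sx , ty)) (inj₁ yz) with B? z
          ... | no z∉B = inj₁ (homogeneousʳ z∉B (proj₁ ty) (S⊆B sx) yz)
          ... | yes z∈B = [ (λ sz → ⊥-elim (T≮S W c sz ty yz)) , (λ tz → inj₂ (sx , tz)) ]′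
                            (S⊎T (rel W) z∈B)
          R-trans (inj₂ (_ , _ , ¬sy)) (inj₂ (sy , _)) = ⊥-elim (¬sy sy)
          R-cotrans : ∀ {x z} y → R x z → R x y ⊎ R y z
          R-cotrans y (inj₁ xz) = [ inj₁ ∘ inj₁ , inj₂ ∘ inj₁ ]′ (cotransitive W y xz)
          R-cotrans y (inj₂ (sx , tz)) with B? y
          ... | no y∉B = [ inj₂ ∘ inj₁ , (λ zy → inj₁ (inj₁ (homogeneousʳ y∉B (proj₁ tz) (S⊆B sx) zy))) ]′
                           (comparable y∉B (proj₁ tz))
          ... | yes y∈B = [ (λ sy → inj₂ (inj₂ (sy , tz))) , (λ ty → inj₁ (inj₂ (sx , ty))) ]′
                            (S⊎T (rel W) y∈B)

        -- `minimal`, applied to the converse of W, yields extremality up to mutual relation; the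
        -- absence of loops on B sharpens it. The same goes for `first`.
        last : ∃ λ s → Sᵂ s × (∀ {z} → Sᵂ z → ¬ W ⟨ s , z ⟩)
        last with minimal {R = λ x y → W ⟨ y , x ⟩} (λ x y → W ⟨ y , x ⟩?) (flip (transitive W))
                    (S? (rel W)) (S-inhabited W c)
        ... | s , s∈S , max = s , s∈S , λ z∈S sz →
          loopless (proj₁ (proj₂ c)) (S⊆B s∈S) (transitive W sz (max z∈S sz))

        first : ∃ λ t → Tᵂ t × (∀ {z} → Tᵂ z → ¬ W ⟨ z , t ⟩)
        first with minimal (W ⟨_,_⟩?) (transitive W) (T? (rel W)) (T-inhabited W c)
        ... | t , t∈T , min = t , t∈T , λ z∈T zt →
          loopless (proj₁ (proj₂ c)) (proj₁ t∈T) (transitive W (min z∈T zt) zt)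

        -- With s in the last block of S and t in the first block of T, the pairs (x , y) with
        -- neither (x , s) nor (t , y) in W are those from the one block to the other. Dropping them
        -- fuses the two blocks.
        join : (∀ {s t} → Sᵂ s → Tᵂ t → W ⟨ s , t ⟩) → ∃ λ W₁ → Splits Sᵂ Tᵂ W₁ W
        join S×T⊆W with last | first
        ... | s , s∈S , s-last | t , t∈T , t-first with realize
          {R = λ x y → W ⟨ x , y ⟩ × (W ⟨ x , s ⟩ ⊎ W ⟨ t , y ⟩)}
          (λ x y → W ⟨ x , y ⟩? ×-dec (W ⟨ x , s ⟩? ⊎-dec W ⟨ t , y ⟩?))
          (λ { (xy , inj₁ xs) (yz , _) → transitive W xy yz , inj₁ xs
             ; (xy , inj₂ ty) (yz , _) → transitive W xy yz , inj₂ (transitive W ty yz) })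
          R-cotrans
          where
          R-cotrans : ∀ {x z} y → W ⟨ x , z ⟩ × (W ⟨ x , s ⟩ ⊎ W ⟨ t , z ⟩) →
            W ⟨ x , y ⟩ × (W ⟨ x , s ⟩ ⊎ W ⟨ t , y ⟩) ⊎ W ⟨ y , z ⟩ × (W ⟨ y , s ⟩ ⊎ W ⟨ t , z ⟩)
          R-cotrans {x} {z} y (xz , inj₁ xs) with W ⟨ x , y ⟩?
          ... | yes xy = inj₁ (xy , inj₁ xs)
          ... | no ¬xy = inj₂ ( [ ⊥-elim ∘ ¬xy , id ]′ (cotransitive W y xz)
                              , inj₁ ([ ⊥-elim ∘ ¬xy , id ]′ (cotransitive W y xs)))
          R-cotrans {x} {z} y (xz , inj₂ tz) with W ⟨ y , z ⟩?
          ... | yes yz = inj₂ (yz , inj₂ tz)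
          ... | no ¬yz = inj₁ ( [ id , ⊥-elim ∘ ¬yz ]′ (cotransitive W y xz)
                              , inj₂ ([ id , ⊥-elim ∘ ¬yz ]′ (cotransitive W y tz)))
        ... | W₁ , spec = W₁ , (s , t , s∈S , t∈T , ¬st) , λ x y → mk⇔ (⇒ x y)
              [ proj₁ ∘ to (spec x y) , uncurry S×T⊆W ]′
          where
          ¬oo = proj₁ (proj₂ c)
          ¬st : ¬ W₁ ⟨ s , t ⟩
          ¬st p = [ loopless ¬oo (S⊆B s∈S) , loopless ¬oo (proj₁ t∈T) ]′ (proj₂ (to (spec s t) p))
          ⇒ : ∀ x y → W ⟨ x , y ⟩ → W₁ ⟨ x , y ⟩ ⊎ (Sᵂ x × Tᵂ y)
          ⇒ x y xy with W ⟨ x , s ⟩? | W ⟨ t , y ⟩?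
          ... | yes xs | _      = inj₁ (from (spec x y) (xy , inj₁ xs))
          ... | no _   | yes ty = inj₁ (from (spec x y) (xy , inj₂ ty))
          ... | no ¬xs | no ¬ty = inj₂ (x∈S , y∈T)
            where
            x∈S : Sᵂ x
            x∈S with B? x
            ... | no x∉B = ⊥-elim ([ ¬xs , (λ sx → ¬ty (transitive W
                    (homogeneousʳ x∉B (S⊆B s∈S) (proj₁ t∈T) sx) xy)) ]′ (comparable x∉B (S⊆B s∈S)))
            ... | yes x∈B = [ id , (λ tx → ⊥-elim ([ t-first tx , ¬ty ]′ (cotransitive W t xy))) ]′
                              (S⊎T (rel W) x∈B)
            y∈T : Tᵂ y
            y∈T with B? y
            ... | no y∉B = ⊥-elim ([ (λ yt → ¬xs (transitive W xy
                    (homogeneousˡ y∉B (proj₁ t∈T) (S⊆B s∈S) yt))) , ¬ty ]′ (comparable y∉B (proj₁ t∈T)))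
            ... | yes y∈B = [ (λ sy → ⊥-elim ([ ¬xs , s-last sy ]′ (cotransitive W s xy))) , id ]′
                              (S⊎T (rel W) y∈B)

        -- New pairs have both ends in one block of W, the only block meeting both S and T. Its part
        -- in S and its part in T are blocks of W′ without any inner pairs, which gives links of the
        -- third kind.
        splits-⋖ : ∀ W′ → Splits Sᵂ Tᵂ W W′ → FinitePoset._⋖_ (bip n) W W′
        splits-⋖ W′ ((s , t , s∈S , t∈T , ¬st) , spec) = linked⇒⋖ W W′ (λ x y → from (spec x y) ∘ inj₁)
          (s , t , from (spec s t) (inj₂ (s∈S , t∈T)) , ¬st) linked
          where
          linked : ∀ {x y x′ y′} → W′ ⟨ x , y ⟩ → ¬ W ⟨ x , y ⟩ → W′ ⟨ x′ , y′ ⟩ → ¬ W ⟨ x′ , y′ ⟩ →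
                   Linked W W′ x′ x × Linked W W′ y y′
          linked {x} {y} {x′} {y′} xy ¬xy xy′ ¬xy′ with to (spec _ _) xy | to (spec _ _) xy′
          ... | inj₁ p | _ = ⊥-elim (¬xy p)
          ... | inj₂ _ | inj₁ p = ⊥-elim (¬xy′ p)
          ... | inj₂ (sx , ty) | inj₂ (sx′ , ty′) =
            inj₂ (inj₂ λ xx′ → [ (λ q → [ ¬xy , T≮S W c sx′ ty ]′ (cotransitive W y q))
                               , (λ (_ , _ , ¬sx′) → ¬sx′ sx′) ]′ (to (spec _ _) xx′)) ,
            inj₂ (inj₂ λ y′y → [ (λ q → [ T≮S W c sx ty′ , ¬xy ]′ (cotransitive W x q))
                               , (λ (sy′ , _) → proj₂ ty′ sy′) ]′ (to (spec _ _) y′y))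

      -- W₁ and W₂ agree with W off S × T, so a pair of W₁ missing from W₂ lies in S × T. Comparing
      -- it in W₁ with the unrelated pair (s , t) yields a pair inside S or inside T; this passes to
      -- W₂, where cotransitivity restores the missing pair.
      lower-⊆ : ∀ R W₁ W₂ W → (∀ {s t} → S R s → T R t → ¬ W₁ ⟨ t , s ⟩) →
                (∀ {s t} → S R s → T R t → ¬ W₂ ⟨ t , s ⟩) →
                Splits (S R) (T R) W₁ W → Splits (S R) (T R) W₂ W → W₁ ⊆ W₂
      lower-⊆ R W₁ W₂ W T≮S₁ T≮S₂ ((s , t , s∈S , t∈T , ¬st) , spec₁) (_ , spec₂) x y xy
        with to (spec₂ x y) (from (spec₁ x y) (inj₁ xy))
      ... | inj₁ p = p
      ... | inj₂ (sx , ty) = decidable-stable (W₂ ⟨ x , y ⟩?) λ ¬xy →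
        [ (λ xs → [ ¬xy , T≮S₂ s∈S ty ]′ (cotransitive W₂ y (to₂-S s∈S xs)))
        , (λ sy → [ ¬st , (λ t′y → [ T≮S₂ sx t∈T , ¬xy ]′ (cotransitive W₂ x (to₂-T t∈T t′y))) ]′
            (cotransitive W₁ t sy)) ]′ (cotransitive W₁ s xy)
        where
        to₂-S : ∀ {a b} → S R b → W₁ ⟨ a , b ⟩ → W₂ ⟨ a , b ⟩
        to₂-S sb ab =
          [ id , (λ (_ , _ , ¬sb) → ⊥-elim (¬sb sb)) ]′ (to (spec₂ _ _) (from (spec₁ _ _) (inj₁ ab)))
        to₂-T : ∀ {a b} → T R a → W₁ ⟨ a , b ⟩ → W₂ ⟨ a , b ⟩
        to₂-T ta ab =
          [ id , (λ (sa , _) → ⊥-elim (proj₂ ta sa)) ]′ (to (spec₂ _ _) (from (spec₁ _ _) (inj₁ ab)))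

      Step : Bip n → Bip n → Set
      Step W W′ = Splits (S (rel W)) (T (rel W)) W W′

      lower-⊆′ : ∀ W₁ W₂ W → Cell E W₁ → Cell E W₂ → Step W₁ W → Step W₂ W → W₁ ⊆ W₂
      lower-⊆′ W₁ W₂ W c₁ c₂ N₁ N₂ = lower-⊆ (rel W) W₁ W₂ W
        (λ sx (ty , ¬sy) → T≮S W₁ c₁ (from (S₁ _) sx) (ty , ¬sy ∘ to (S₁ _)))
        (λ sx (ty , ¬sy) → T≮S W₂ c₂ (from (S₂ _) sx) (ty , ¬sy ∘ to (S₂ _)))
        (splits-cong {rel W₁} {rel W} {W₁} {W} S₁ N₁) (splits-cong {rel W₂} {rel W} {W₂} {W} S₂ N₂)
        where
        S₁ = proj₂ (stable↑ W₁ W c₁ N₁)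
        S₂ = proj₂ (stable↑ W₂ W c₂ N₂)

      pairing : Pairing (Cell E) Step rk
      pairing = record
        { P-resp  = λ { {_ , _} {_ , _} refl p → p }
        ; N-respˡ = λ { {_ , _} {_ , _} refl p → p }
        ; N-respʳ = λ { {_} {_ , _} {_ , _} refl p → p }
        ; partner = λ {W} → partner W
        ; upper-unique = λ {x} {y} {y′} _ _ _ (_ , spec) (_ , spec′) → ⊆-antisymmetric y y′
            (λ a b → from (spec′ a b) ∘ to (spec a b)) (λ a b → from (spec a b) ∘ to (spec′ a b))
        ; lower-unique = λ {x} {x′} {y} p p′ _ N N′ → ⊆-antisymmetric x x′
            (lower-⊆′ x x′ y p p′ N N′) (lower-⊆′ x′ x y p′ p N′ N)
        ; lower≢upper = λ {x} {y} {z} p _ _ N ((s , t , s∈S , (t∈B , ¬st) , ¬st′) , _) →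
            let S≗ = proj₂ (stable↑ x y p N)
            in ¬st′ (from (proj₂ N s t) (inj₂ (from (S≗ s) s∈S , t∈B , ¬st ∘ to (S≗ t))))
        ; parity = λ {x} {y} p _ N → cover-parity {x} {y} (splits-⋖ x p y N)
        }
        where
        partner : ∀ W → Cell E W → ∃ λ W′ → Cell E W′ × (Step W W′ ⊎ Step W′ W)
        partner W c with any? (λ s → any? λ t → S? (rel W) s ×-dec T? (rel W) t ×-dec ¬? (W ⟨ s , t ⟩?))
        ... | yes mixed = let W′ , spec = split W c ; N = mixed , spec in W′ , cell↑ W W′ c N , inj₁ N
        ... | no ¬mixed = let W₁ , N = join W c (λ {s} {t} s∈S t∈T → decidable-stable (W ⟨ s , t ⟩?)
                                λ ¬st → ¬mixed (s , t , s∈S , t∈T , ¬st))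
                          in W₁ , cell↓ W₁ W c N ,
                             inj₂ (splits-cong {rel W} {rel W₁} {W₁} {W} (proj₂ (stable↓ W₁ W c N)) N)

  -- Second matching: V separates a nonunderlined block of U.

  module SplitByV (U V : Bip n) {x y : Fin n} (¬Uxy : ¬ U ⟨ x , y ⟩) (¬Uyx : ¬ U ⟨ y , x ⟩)
                  (Vxy : V ⟨ x , y ⟩) (¬Vyx : ¬ V ⟨ y , x ⟩) where

    ¬Uxx : ¬ U ⟨ x , x ⟩
    ¬Uxx xx = [ ¬Uxy , ¬Uyx ]′ (cotransitive U y xx)

    open NonunderlinedClass U V x ¬Uxx

    -- B is cut at x as V sees it: x falls into S, and y, being strictly after x in V, into T.
    After : Fin n → Set
    After b = V ⟨ x , b ⟩ × ¬ V ⟨ b , x ⟩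

    after? : ∀ b → Dec (After b)
    after? b = V ⟨ x , b ⟩? ×-dec ¬? (V ⟨ b , x ⟩?)

    not-after : ∀ {b} → ¬ After b → V ⟨ x , b ⟩ → V ⟨ b , x ⟩
    not-after {b} ¬after xb = decidable-stable (V ⟨ b , x ⟩?) λ ¬bx → ¬after (xb , ¬bx)

    after : ∀ {b} → ¬ (B b × ¬ After b) → B b → After b
    after {b} ¬S b∈B = decidable-stable (after? b) λ ¬a → ¬S (b∈B , ¬a)

    S : Relation n → Fin n → Set
    S _ b = B b × ¬ After b

    S? : ∀ R b → Dec (S R b)
    S? _ b = B? b ×-dec ¬? (after? b)

    T≮S : ∀ W → Cell (λ _ → ⊤) W → ∀ {s t} → S (rel W) s → Rest S (rel W) t → ¬ W ⟨ t , s ⟩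
    T≮S W ((_ , W⊆V , _) , _) (_ , ¬as) (t∈B , ¬St) ts with after ¬St t∈B
    ... | xt , ¬tx =
      ¬tx (transitive V (W⊆V _ _ ts) (not-after ¬as (transitive V xt (W⊆V _ _ ts))))

    S×T⊆V : ∀ W → Cell (λ _ → ⊤) W → ∀ {s t} → S (rel W) s → Rest S (rel W) t → V ⟨ s , t ⟩
    S×T⊆V W _ {s} (_ , ¬as) (t∈B , ¬St) with after ¬St t∈B
    ... | xt , _ = [ (λ xs → transitive V (not-after ¬as xs) xt) , id ]′ (cotransitive V s xt)

    open Toggle S S? (λ _ → ⊤) proj₁ T≮S S×T⊆V
      (λ _ _ → x , o∈B , λ (xx , ¬xx) → ¬xx xx)
      (λ _ _ → y , (¬Uxy , ¬Uyx) , λ (_ , ¬a) → ¬a (Vxy , ¬Vyx))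
      (λ _ _ _ _ → tt , λ _ → mk⇔ id id)
      (λ _ _ _ _ → tt , λ _ → mk⇔ id id)

    -- Underlining x would underline all of B, forcing (y , x) into V. Hence every `Mid` is a cell
    -- and the toggle matches all of them.
    nonunderlined : ∀ W → Mid U V W → ¬ W ⟨ x , x ⟩
    nonunderlined W (U⊆W , W⊆V , regular) xx =
      ¬Vyx (W⊆V _ _ (Regular.full W U⊆W regular xx (¬Uxy , ¬Uyx) o∈B))

    vanishes : signedSum (mid? U V) ≡ 0ℤ
    vanishes = pairing⇒0 (mid? U V) record
      { P-resp = λ { {_ , _} {_ , _} refl p → p }
      ; N-respˡ = λ {a} {b} {c} → N-respˡ {a} {b} {c}
      ; N-respʳ = λ {a} {b} {c} → N-respʳ {a} {b} {c}
      ; partner = λ {W} p → let W′ , c , N = partner {W} (cell W p) in W′ , proj₁ c , N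
      ; upper-unique = λ {a} {b} {c} p q r → upper-unique {a} {b} {c} (cell a p) (cell b q) (cell c r)
      ; lower-unique = λ {a} {b} {c} p q r → lower-unique {a} {b} {c} (cell a p) (cell b q) (cell c r)
      ; lower≢upper = λ {a} {b} {c} p q r → lower≢upper {a} {b} {c} (cell a p) (cell b q) (cell c r)
      ; parity = λ {a} {b} p q → parity {a} {b} (cell a p) (cell b q)
      }
      where
      open Pairing pairing
      cell : ∀ W → Mid U V W → Cell (λ _ → ⊤) W
      cell W mid = mid , nonunderlined W mid , tt

  -- Third matching: V contains the square of a nonunderlined block of U.

  module Flip (U V : Bip n) (o : Fin n) (¬Uoo : ¬ U ⟨ o , o ⟩) where

    open NonunderlinedClass U V o ¬Uoo

    -- For an ordered partition R of B: the elements of index below k are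
    -- singleton blocks, in increasing order, followed by the rest of B.
    Sorted : ℕ → Relation n → Set
    Sorted k R = ∀ b y → toℕ b ℕ.< k → B b → B y → toℕ b ℕ.< toℕ y → R [ b , y ]

    sorted? : ∀ k R → Dec (Sorted k R)
    sorted? k R = all? λ b → all? λ y → (toℕ b ℕ.<? k) →-dec B? b →-dec B? y →-dec
      (toℕ b ℕ.<? toℕ y) →-dec (R [ b , y ]?)

    -- A W that underlines B belongs to every stage and finds its partner only in the last one.
    -- Stage 0 is all of `Mid`; in stage n, B is either in increasing order or underlined.
    Stage : ℕ → Bip n → Set
    Stage k W = Mid U V W × (¬ W ⟨ o , o ⟩ → Sorted k (rel W))

    stage? : ∀ k W → Dec (Stage k W)
    stage? k W = mid? U V W ×-dec (¬? (W ⟨ o , o ⟩?) →-dec sorted? k (rel W))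

    module _ (B²⊆V : ∀ {x y} → B x → B y → V ⟨ x , y ⟩) where

      module Insert (a : Fin n) (a∈B : B a) where

        Unsorted : Relation n → Set
        Unsorted R = Sorted (toℕ a) R × ∃ λ y → toℕ a ℕ.< toℕ y × B y × ¬ R [ a , y ]

        -- The blocks before that of a, and the rest of the block of a. The first block of the
        -- complement in B is then {a}, so toggling moves a into the preceding block or out of its
        -- own.
        S : Relation n → Fin n → Set
        S R x = B x × ¬ x ≡ a × ¬ R [ a , x ]

        a∉S : ∀ {R} → ¬ S R a
        a∉S (_ , ¬a≡a , _) = ¬a≡a refl

        not-S : ∀ {R t} → B t → ¬ S R t → t ≡ a ⊎ R [ a , t ]
        not-S {R} {t} t∈B ¬S with t ≟ᶠ a | R [ a , t ]?
        ... | yes t≡a | _      = inj₁ t≡a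
        ... | no  _   | yes at = inj₂ at
        ... | no  t≢a | no ¬at = ⊥-elim (¬S (t∈B , t≢a , ¬at))

        not-before : ∀ W {s t} → S (rel W) s → B t → ¬ S (rel W) t → ¬ W ⟨ t , s ⟩
        not-before W (_ , _ , ¬as) t∈B ¬St ts with not-S {rel W} t∈B ¬St
        ... | inj₁ refl = ¬as ts
        ... | inj₂ at   = ¬as (transitive W at ts)

        S? : ∀ R x → Dec (S R x)
        S? R x = B? x ×-dec ¬? (x ≟ᶠ a) ×-dec ¬? (R [ a , x ]?)

        -- Adding S × T leaves row a alone because a is not in S; since S is read off from row a, it
        -- is the same for both partners.
        row-stable : ∀ {R W W′} → Splits (S R) (Rest S R) W W′ → ∀ y → W ⟨ a , y ⟩ ⇔ W′ ⟨ a , y ⟩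
        row-stable {R} (_ , spec) y = mk⇔ (from (spec a y) ∘ inj₁)
          (λ ay → [ id , (λ (sa , _) → ⊥-elim (a∉S {R} sa)) ]′ (to (spec a y) ay))

        S-stable : ∀ {R R′} → (∀ y → R [ a , y ] ⇔ R′ [ a , y ]) → ∀ x → S R x ⇔ S R′ x
        S-stable row x = mk⇔ (λ (b , x≢a , ¬ax) → b , x≢a , ¬ax ∘ from (row x))
                             (λ (b , x≢a , ¬ax) → b , x≢a , ¬ax ∘ to (row x))

        later-in-S : ∀ {R} y → toℕ a ℕ.< toℕ y → B y → ¬ R [ a , y ] → S R y
        later-in-S y a<y y∈B ¬ay = y∈B , (λ { refl → ℕ.<-irrefl refl a<y }) , ¬ay

        -- If (b , z) were added by the step, compare with y in S: (b , y) is not an added pair, so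
        -- it is in W, and cotransitivity through z leaves (b , z), as (z , y) would put T before S.
        lower-sorted : ∀ W W′ → Splits (S (rel W′)) (Rest S (rel W′)) W W′ → Sorted (toℕ a) (rel W′) →
                       ∀ y → toℕ a ℕ.< toℕ y → B y → ¬ W′ ⟨ a , y ⟩ → Sorted (toℕ a) (rel W)
        lower-sorted W W′ (_ , spec) sorted y a<y y∈B ¬ay b z b<a b∈B z∈B b<z
          with to (spec b z) (sorted b z b<a b∈B z∈B b<z)
        ... | inj₁ bz = bz
        ... | inj₂ (_ , _ , z∉S) = [ id , (λ zy → ⊥-elim
                (not-before W′ y∈S z∈B z∉S (from (spec z y) (inj₁ zy)))) ]′ (cotransitive W z by)
          where
          y∈S : S (rel W′) y
          y∈S = later-in-S {rel W′} y a<y y∈B ¬ay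
          by : W ⟨ b , y ⟩
          by = [ id , (λ (_ , _ , y∉S) → ⊥-elim (y∉S y∈S)) ]′
            (to (spec b y) (sorted b y b<a b∈B y∈B (ℕ.<-trans b<a a<y)))

        S-inhabited : ∀ W → Cell Unsorted W → ∃ (S (rel W))
        S-inhabited W (_ , _ , _ , y , a<y , y∈B , ¬ay) = y , later-in-S {rel W} y a<y y∈B ¬ay

        stable↑ : ∀ W W′ → Cell Unsorted W → Splits (S (rel W)) (Rest S (rel W)) W W′ →
                  Unsorted (rel W′) × (∀ x → S (rel W) x ⇔ S (rel W′) x)
        stable↑ W W′ (_ , _ , sorted , y , a<y , y∈B , ¬ay) N =
          ((λ b z b<a b∈B z∈B b<z → from (proj₂ N b z) (inj₁ (sorted b z b<a b∈B z∈B b<z)))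
          , y , a<y , y∈B , ¬ay ∘ from (row y)) , S-stable {rel W} {rel W′} row
          where
          row : ∀ y → W ⟨ a , y ⟩ ⇔ W′ ⟨ a , y ⟩
          row = row-stable {rel W} {W} {W′} N

        stable↓ : ∀ W W′ → Cell Unsorted W′ → Splits (S (rel W′)) (Rest S (rel W′)) W W′ →
                  Unsorted (rel W) × (∀ x → S (rel W′) x ⇔ S (rel W) x)
        stable↓ W W′ (_ , _ , sorted , y , a<y , y∈B , ¬ay) N =
          (lower-sorted W W′ N sorted y a<y y∈B ¬ay , y , a<y , y∈B , ¬ay ∘ to (row y)) ,
          S-stable {rel W′} {rel W} (λ z → mk⇔ (from (row z)) (to (row z)))
          where
          row : ∀ y → W ⟨ a , y ⟩ ⇔ W′ ⟨ a , y ⟩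
          row = row-stable {rel W′} {W} {W′} N

        open Toggle S S? Unsorted proj₁
          (λ W _ sx (t∈B , ¬St) → not-before W sx t∈B ¬St)
          (λ W _ sx (t∈B , _) → B²⊆V (proj₁ sx) t∈B)
          S-inhabited
          (λ W _ → a , a∈B , a∉S {rel W})
          stable↑ stable↓
          public using (pairing)

        cell⇔ : ∀ W → Cell Unsorted W ⇔ (Stage (toℕ a) W × ¬ Stage (suc (toℕ a)) W)
        cell⇔ W = mk⇔
          (λ { (mid , ¬oo , sorted , y , a<y , y∈B , ¬ay) → (mid , λ _ → sorted) ,
               λ (_ , sorted′) → ¬ay (sorted′ ¬oo a y ℕ.≤-refl a∈B y∈B a<y) })
          ⇐
          where
          ⇐ : Stage (toℕ a) W × ¬ Stage (suc (toℕ a)) W → Cell Unsorted W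
          ⇐ ((mid , sorted) , ¬stage) with W ⟨ o , o ⟩?
          ... | yes oo = ⊥-elim (¬stage (mid , λ ¬oo → ⊥-elim (¬oo oo)))
          ... | no ¬oo with any? (λ y → (toℕ a ℕ.<? toℕ y) ×-dec B? y ×-dec ¬? (W ⟨ a , y ⟩?))
          ...   | yes unsorted = mid , ¬oo , sorted ¬oo , unsorted
          ...   | no ¬unsorted = ⊥-elim (¬stage (mid , λ _ → sorted′))
            where
            sorted′ : Sorted (suc (toℕ a)) (rel W)
            sorted′ b y b≤a b∈B y∈B b<y with ℕ.m≤n⇒m<n∨m≡n (ℕ.≤-pred b≤a)
            ... | inj₁ b<a = sorted ¬oo b y b<a b∈B y∈B b<y
            ... | inj₂ b≡a with toℕ-injective b≡a
            ...   | refl = decidable-stable (W ⟨ a , y ⟩?) λ ¬ay → ¬unsorted (y , b<y , y∈B , ¬ay)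

      difference? : ∀ k W → Dec (Stage k W × ¬ Stage (suc k) W)
      difference? k W = stage? k W ×-dec ¬? (stage? (suc k) W)

      -- If k is the index of an element of B, the difference consists of the cells of `Insert`;
      -- otherwise the two stages coincide.
      difference-vanishes : ∀ k → signedSum (difference? k) ≡ 0ℤ
      difference-vanishes k with any? (λ a → B? a ×-dec (toℕ a ℕ.≟ k))
      ... | yes (a , a∈B , refl) = trans
        (signedSum-cong (difference? (toℕ a)) cell?
          (λ {W} → from (Insert.cell⇔ a a∈B W)) (λ {W} → to (Insert.cell⇔ a a∈B W)))
        (pairing⇒0 cell? (Insert.pairing a a∈B))
        where
        cell? : ∀ W → Dec (Cell (Insert.Unsorted a a∈B) W)
        cell? W = map′ (from (Insert.cell⇔ a a∈B W)) (to (Insert.cell⇔ a a∈B W)) (difference? (toℕ a) W)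
      ... | no none = trans
        (sum-cong (FinitePoset.elements (bip n)) λ W → χ-false (difference? k W) (empty W))
        (sum-zero (FinitePoset.elements (bip n)))
        where
        empty : ∀ W → ¬ (Stage k W × ¬ Stage (suc k) W)
        empty W ((mid , sorted) , ¬stage) = ¬stage (mid , λ ¬oo b y b≤k b∈B y∈B b<y →
          [ (λ b<k → sorted ¬oo b y b<k b∈B y∈B b<y) , (λ b≡k → ⊥-elim (none (b , b∈B , b≡k))) ]′
          (ℕ.m≤n⇒m<n∨m≡n (ℕ.≤-pred b≤k)))

      -- The linear order with the elements of index below k merged into one
      -- underlined block; k = 0 is the linear order and k = n the full relation.
      Q : ℕ → Fin n → Fin n → Set
      Q k x y = toℕ x ℕ.< k ⊎ toℕ x ℕ.< toℕ y

      Q? : ∀ k x y → Dec (Q k x y)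
      Q? k x y = (toℕ x ℕ.<? k) ⊎-dec (toℕ x ℕ.<? toℕ y)

      Q-trans : ∀ k {x y z} → Q k x y → Q k y z → Q k x z
      Q-trans k (inj₁ x<k) _          = inj₁ x<k
      Q-trans k (inj₂ x<y) (inj₁ y<k) = inj₁ (ℕ.<-trans x<y y<k)
      Q-trans k (inj₂ x<y) (inj₂ y<z) = inj₂ (ℕ.<-trans x<y y<z)

      Q-cotrans : ∀ k {x z} y → Q k x z → Q k x y ⊎ Q k y z
      Q-cotrans k y (inj₁ x<k) = inj₁ (inj₁ x<k)
      Q-cotrans k {x} y (inj₂ x<z) with toℕ x ℕ.<? toℕ y
      ... | yes x<y = inj₁ (inj₂ x<y)
      ... | no  x≮y = inj₂ (inj₂ (ℕ.≤-<-trans (ℕ.≮⇒≥ x≮y) x<z))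

      -- The intermediate step from Q (toℕ a) to Q (suc (toℕ a)) when the merged
      -- block is nonempty: the singleton block of a is underlined but not yet merged.
      Q⁺ : Fin n → Fin n → Fin n → Set
      Q⁺ a x y = Q (toℕ a) x y ⊎ (x ≡ a × y ≡ a)

      Q⁺? : ∀ a x y → Dec (Q⁺ a x y)
      Q⁺? a x y = Q? (toℕ a) x y ⊎-dec ((x ≟ᶠ a) ×-dec (y ≟ᶠ a))

      Q⁺-trans : ∀ a {x y z} → Q⁺ a x y → Q⁺ a y z → Q⁺ a x z
      Q⁺-trans a (inj₁ xy) (inj₁ yz) = inj₁ (Q-trans (toℕ a) xy yz)
      Q⁺-trans a (inj₁ xy) (inj₂ (refl , refl)) = inj₁ xy
      Q⁺-trans a (inj₂ (refl , refl)) yz = yz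

      Q⁺-cotrans : ∀ a {x z} y → Q⁺ a x z → Q⁺ a x y ⊎ Q⁺ a y z
      Q⁺-cotrans a y (inj₁ xz) = [ inj₁ ∘ inj₁ , inj₂ ∘ inj₁ ]′ (Q-cotrans (toℕ a) y xz)
      Q⁺-cotrans a y (inj₂ (refl , refl)) with ℕ.<-cmp (toℕ y) (toℕ a)
      ... | tri< y<a _ _ = inj₂ (inj₁ (inj₁ y<a))
      ... | tri≈ _ y≡a _ = inj₁ (inj₂ (refl , toℕ-injective y≡a))
      ... | tri> _ _ a<y = inj₁ (inj₁ (inj₂ a<y))

      module Chain (W : Bip n) (mid : Mid U V W)
                   (linear : ∀ {x y} → B x → B y → W ⟨ x , y ⟩ ⇔ (toℕ x ℕ.< toℕ y)) where

        open Regular W (proj₁ mid) (proj₂ (proj₂ mid))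
        module Lower (k : ℕ) = Replacement (Q? k)
          (λ {x} {y} {z} → Q-trans k {x} {y} {z}) (λ {x} {z} → Q-cotrans k {x} {z})
        module Upper (a : Fin n) = Replacement (Q⁺? a)
          (λ {x} {y} {z} → Q⁺-trans a {x} {y} {z}) (λ {x} {z} → Q⁺-cotrans a {x} {z})

        M : ℕ → Bip n
        M k = proj₁ (Lower.replaced k)

        M⁺ : Fin n → Bip n
        M⁺ a = proj₁ (Upper.replaced a)

        open Lower using () renaming (replaced-inside to M-inside; replaced-agrees to M-agrees)
        open Upper using () renaming (replaced-inside to M⁺-inside; replaced-agrees to M⁺-agrees)

        agreeing-≈ : ∀ Z Z′ → AgreeOutside W Z → AgreeOutside W Z′ →
                     (∀ {x y} → B x → B y → Z ⟨ x , y ⟩ ⇔ Z′ ⟨ x , y ⟩) → Z ≈ Z′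
        agreeing-≈ Z Z′ agree agree′ inside =
          ⊆-antisymmetric Z Z′ (λ x y → to (same x y)) (λ x y → from (same x y))
          where
          same : ∀ x y → Z ⟨ x , y ⟩ ⇔ Z′ ⟨ x , y ⟩
          same x y with B²? x y
          ... | yes (x∈B , y∈B) = inside x∈B y∈B
          ... | no ∉B = mk⇔ (to (agree′ x y ∉B) ∘ from (agree x y ∉B))
                           (to (agree x y ∉B) ∘ from (agree′ x y ∉B))

        agreeing-⋖ : ∀ Z Z′ → AgreeOutside W Z → AgreeOutside W Z′ →
          (∀ {x y} → B x → B y → Z ⟨ x , y ⟩ → Z′ ⟨ x , y ⟩) →
          (∃₂ λ x y → Z′ ⟨ x , y ⟩ × ¬ Z ⟨ x , y ⟩) →
          (∀ {x y x′ y′} → B² x y → B² x′ y′ → Z′ ⟨ x , y ⟩ → ¬ Z ⟨ x , y ⟩ →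
            Z′ ⟨ x′ , y′ ⟩ → ¬ Z ⟨ x′ , y′ ⟩ → Linked Z Z′ x′ x × Linked Z Z′ y y′) →
          FinitePoset._⋖_ (bip n) Z Z′
        agreeing-⋖ Z Z′ agree agree′ inside new linked = linked⇒⋖ Z Z′ Z⊆Z′ new
          λ xy ¬xy xy′ ¬xy′ → linked (in-B xy ¬xy) (in-B xy′ ¬xy′) xy ¬xy xy′ ¬xy′
          where
          Z⊆Z′ : Z ⊆ Z′
          Z⊆Z′ x y xy with B²? x y
          ... | yes (x∈B , y∈B) = inside x∈B y∈B xy
          ... | no ∉B = to (agree′ x y ∉B) (from (agree x y ∉B) xy)
          in-B : ∀ {x y} → Z′ ⟨ x , y ⟩ → ¬ Z ⟨ x , y ⟩ → B² x y
          in-B {x} {y} xy ¬xy with B²? x y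
          ... | yes ∈B = ∈B
          ... | no ∉B  = ⊥-elim (¬xy (to (agree x y ∉B) (from (agree′ x y ∉B) xy)))

        NoneBelow : ℕ → Set
        NoneBelow k = ∀ {b} → B b → ¬ toℕ b ℕ.< k

        M-initial : ∀ {k} → NoneBelow k → M k ≈ W
        M-initial {k} none =
          agreeing-≈ (M k) W (M-agrees k) (λ _ _ _ → mk⇔ id id) λ x∈B y∈B → mk⇔
          (λ xy → from (linear x∈B y∈B) ([ ⊥-elim ∘ none x∈B , id ]′ (to (M-inside k x∈B y∈B) xy)))
          (λ xy → from (M-inside k x∈B y∈B) (inj₂ (to (linear x∈B y∈B) xy)))

        M-skip : ∀ {k} → (∀ {b} → B b → ¬ toℕ b ≡ k) → M (suc k) ≈ M k
        M-skip {k} ∉B =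
          agreeing-≈ (M (suc k)) (M k) (M-agrees (suc k)) (M-agrees k) λ x∈B y∈B → mk⇔
          (λ xy → from (M-inside k x∈B y∈B)
            ([ (λ x≤k → inj₁ (ℕ.≤∧≢⇒< (ℕ.≤-pred x≤k) (∉B x∈B))) , inj₂ ]′
            (to (M-inside (suc k) x∈B y∈B) xy)))
          (λ xy → from (M-inside (suc k) x∈B y∈B)
            ([ inj₁ ∘ ℕ.m<n⇒m<1+n , inj₂ ]′ (to (M-inside k x∈B y∈B) xy)))

        module _ (a : Fin n) (a∈B : B a) where

          new-source : ∀ {x y} → Q (suc (toℕ a)) x y → ¬ Q (toℕ a) x y → x ≡ a × toℕ y ℕ.≤ toℕ a
          new-source {x} {y} (inj₁ x≤a) ¬q with toℕ-injective (ℕ.≤-antisym (ℕ.≤-pred x≤a) (ℕ.≮⇒≥ (¬q ∘ inj₁)))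
          ... | refl = refl , ℕ.≮⇒≥ (¬q ∘ inj₂)
          new-source (inj₂ x<y) ¬q = ⊥-elim (¬q (inj₂ x<y))

          Q-up : ∀ {x y} → Q (toℕ a) x y → Q (suc (toℕ a)) x y
          Q-up = [ inj₁ ∘ ℕ.m<n⇒m<1+n , inj₂ ]′

          M⋖M-first : NoneBelow (toℕ a) → FinitePoset._⋖_ (bip n) (M (toℕ a)) (M (suc (toℕ a)))
          M⋖M-first none = agreeing-⋖ (M (toℕ a)) (M (suc (toℕ a)))
            (M-agrees (toℕ a)) (M-agrees (suc (toℕ a)))
            (λ x∈B y∈B xy → from (M-inside (suc (toℕ a)) x∈B y∈B)
              (Q-up (to (M-inside (toℕ a) x∈B y∈B) xy)))
            (a , a , from (M-inside (suc (toℕ a)) a∈B a∈B) (inj₁ ℕ.≤-refl)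
                   , λ aa → [ ℕ.<-irrefl refl , ℕ.<-irrefl refl ]′ (to (M-inside (toℕ a) a∈B a∈B) aa))
            λ xy∈B xy′∈B xy ¬xy xy′ ¬xy′ →
              let x≡a , y≡a = only xy∈B xy ¬xy ; x′≡a , y′≡a = only xy′∈B xy′ ¬xy′ in
              inj₁ (trans x′≡a (sym x≡a)) , inj₁ (trans y≡a (sym y′≡a))
            where
            only : ∀ {x y} → B² x y → M (suc (toℕ a)) ⟨ x , y ⟩ → ¬ M (toℕ a) ⟨ x , y ⟩ → x ≡ a × y ≡ a
            only (x∈B , y∈B) xy ¬xy with new-source (to (M-inside (suc (toℕ a)) x∈B y∈B) xy)
                                          (¬xy ∘ from (M-inside (toℕ a) x∈B y∈B))
            ... | x≡a , y≤a = x≡a , toℕ-injective (ℕ.≤-antisym y≤a (ℕ.≮⇒≥ (none y∈B)))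

          M⋖M⁺ : FinitePoset._⋖_ (bip n) (M (toℕ a)) (M⁺ a)
          M⋖M⁺ = agreeing-⋖ (M (toℕ a)) (M⁺ a)
            (M-agrees (toℕ a)) (M⁺-agrees a)
            (λ x∈B y∈B xy → from (M⁺-inside a x∈B y∈B)
              (inj₁ (to (M-inside (toℕ a) x∈B y∈B) xy)))
            (a , a , from (M⁺-inside a a∈B a∈B) (inj₂ (refl , refl))
                   , λ aa → [ ℕ.<-irrefl refl , ℕ.<-irrefl refl ]′ (to (M-inside (toℕ a) a∈B a∈B) aa))
            λ xy∈B xy′∈B xy ¬xy xy′ ¬xy′ →
              let x≡a , y≡a = only xy∈B xy ¬xy ; x′≡a , y′≡a = only xy′∈B xy′ ¬xy′ in
              inj₁ (trans x′≡a (sym x≡a)) , inj₁ (trans y≡a (sym y′≡a))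
            where
            only : ∀ {x y} → B² x y → M⁺ a ⟨ x , y ⟩ → ¬ M (toℕ a) ⟨ x , y ⟩ → x ≡ a × y ≡ a
            only (x∈B , y∈B) xy ¬xy =
              [ (λ q → ⊥-elim (¬xy (from (M-inside (toℕ a) x∈B y∈B) q))) , id ]′
              (to (M⁺-inside a x∈B y∈B) xy)

          -- The new pairs are (a , y) with y in B below a. These y form one underlined block of
          -- `M⁺ a`, so the targets are linked; `b` supplies a new pair.
          M⁺⋖M : ∀ {b} → B b → toℕ b ℕ.< toℕ a → FinitePoset._⋖_ (bip n) (M⁺ a) (M (suc (toℕ a)))
          M⁺⋖M {b} b∈B b<a = agreeing-⋖ (M⁺ a) (M (suc (toℕ a)))
            (M⁺-agrees a) (M-agrees (suc (toℕ a)))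
            (λ x∈B y∈B xy → from (M-inside (suc (toℕ a)) x∈B y∈B)
              ([ Q-up , (λ { (refl , refl) → inj₁ ℕ.≤-refl }) ]′ (to (M⁺-inside a x∈B y∈B) xy)))
            (a , b , from (M-inside (suc (toℕ a)) a∈B b∈B) (inj₁ ℕ.≤-refl)
                   , λ ab → [ [ ℕ.<-irrefl refl , ℕ.<-asym b<a ]′ , (λ { (_ , refl) → ℕ.<-irrefl refl b<a }) ]′
                       (to (M⁺-inside a a∈B b∈B) ab))
            λ xy∈B xy′∈B xy ¬xy xy′ ¬xy′ →
              let x≡a , y<a = only xy∈B xy ¬xy ; x′≡a , _ = only xy′∈B xy′ ¬xy′ in
              inj₁ (trans x′≡a (sym x≡a)) ,
              inj₂ (inj₁ (from (M⁺-inside a (proj₂ xy∈B) (proj₂ xy′∈B)) (inj₁ (inj₁ y<a))))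
            where
            only : ∀ {x y} → B² x y → M (suc (toℕ a)) ⟨ x , y ⟩ → ¬ M⁺ a ⟨ x , y ⟩ → x ≡ a × toℕ y ℕ.< toℕ a
            only (x∈B , y∈B) xy ¬xy with new-source (to (M-inside (suc (toℕ a)) x∈B y∈B) xy)
                                          (¬xy ∘ from (M⁺-inside a x∈B y∈B) ∘ inj₁)
            ... | refl , y≤a = refl , ℕ.≤∧≢⇒< y≤a λ y≡a →
                    ¬xy (from (M⁺-inside a x∈B y∈B) (inj₂ (refl , toℕ-injective y≡a)))

        -- While no element of B has been reached, `M k` is still W. The first element then costs
        -- one cover and every later one two, through `M⁺`, so the sign flips once and stays.
        M-parity : ∀ k → NoneBelow k ⊎ sign (rk (M k)) ≡ - sign (rk W)
        M-parity zero = inj₁ λ _ ()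
        M-parity (suc k) with any? (λ a → B? a ×-dec (toℕ a ℕ.≟ k)) | M-parity k
        ... | no none | inj₁ low = inj₁ λ {b} b∈B b≤k →
          low b∈B (ℕ.≤∧≢⇒< (ℕ.≤-pred b≤k) λ b≡k → none (b , b∈B , b≡k))
        ... | no none | inj₂ odd = inj₂ (trans
          (cong sign (rank-cong {M (suc k)} {M k} (M-skip λ {b} b∈B b≡k → none (b , b∈B , b≡k)))) odd)
        ... | yes (a , a∈B , refl) | previous with any? (λ b → B? b ×-dec (toℕ b ℕ.<? toℕ a)) | previous
        ...   | no none | _ = inj₂ (trans (cover-parity {M (toℕ a)} {M (suc (toℕ a))} (M⋖M-first a a∈B low))
                (cong (-_ ∘ sign) (rank-cong {M (toℕ a)} {W} (M-initial low))))
          where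
          low : NoneBelow (toℕ a)
          low {b} b∈B b<a = none (b , b∈B , b<a)
        ...   | yes (b , b∈B , b<a) | inj₁ low = ⊥-elim (low b∈B b<a)
        ...   | yes (b , b∈B , b<a) | inj₂ odd = inj₂ (begin
          sign (rk (M (suc (toℕ a))))  ≡⟨ cover-parity {M⁺ a} {M (suc (toℕ a))} (M⁺⋖M a a∈B b∈B b<a) ⟩
          - sign (rk (M⁺ a))           ≡⟨ cong -_ (cover-parity {M (toℕ a)} {M⁺ a} (M⋖M⁺ a a∈B)) ⟩
          - - sign (rk (M (toℕ a)))    ≡⟨ ℤ.neg-involutive _ ⟩
          sign (rk (M (toℕ a)))        ≡⟨ odd ⟩
          - sign (rk W)                ∎)
          where open ≡-Reasoning

        full-parity : ∀ W′ → AgreeOutside W W′ → (∀ {x y} → B x → B y → W′ ⟨ x , y ⟩) →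
                      sign (rk W′) ≡ - sign (rk W)
        full-parity W′ agree full with M-parity n
        ... | inj₁ low = ⊥-elim (low o∈B (toℕ<n o))
        ... | inj₂ odd = trans (cong sign (rank-cong {W′} {M n}
          (agreeing-≈ W′ (M n) agree (M-agrees n)
          λ x∈B y∈B → mk⇔ (λ _ → from (M-inside n x∈B y∈B) (inj₁ (toℕ<n _)))
                           (λ _ → full x∈B y∈B)))) odd

      Fills : Bip n → Bip n → Set
      Fills W W′ = (∀ x y → B x → B y → W ⟨ x , y ⟩ ⇔ (toℕ x ℕ.< toℕ y)) ×
                   (∀ x y → B x → B y → W′ ⟨ x , y ⟩) × AgreeOutside W W′

      -- For each behaviour outside B, exactly two relations remain, the increasing order on B and
      -- the full square; `Chain` shows that their ranks have opposite parity.
      last-stage-vanishes : signedSum (stage? n) ≡ 0ℤ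
      last-stage-vanishes = pairing⇒0 (stage? n) record
        { P-resp  = λ { {_ , _} {_ , _} refl p → p }
        ; N-respˡ = λ { {_ , _} {_ , _} refl p → p }
        ; N-respʳ = λ { {_} {_ , _} {_ , _} refl p → p }
        ; partner = λ {W} → partner W
        ; upper-unique = λ {W} {W₁} {W₂} _ _ _ (_ , full₁ , agree₁) (_ , full₂ , agree₂) →
            ⊆-antisymmetric W₁ W₂
            (upper-⊆ W W₁ W₂ agree₁ agree₂ full₂) (upper-⊆ W W₂ W₁ agree₂ agree₁ full₁)
        ; lower-unique = λ {W₁} {W₂} {W} _ _ _ (linear₁ , _ , agree₁) (linear₂ , _ , agree₂) →
            ⊆-antisymmetric W₁ W₂
            (lower-⊆ W W₁ W₂ agree₁ agree₂ linear₁ linear₂) (lower-⊆ W W₂ W₁ agree₂ agree₁ linear₂ linear₁)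
        ; lower≢upper = λ _ _ _ (_ , full , _) (linear , _) →
            ℕ.<-irrefl refl (to (linear o o o∈B o∈B) (full o o o∈B o∈B))
        ; parity = λ {W} {W′} (mid , _) _ (linear , full , agree) →
            Chain.full-parity W mid (λ x∈B y∈B → linear _ _ x∈B y∈B) W′ agree
              (λ x∈B y∈B → full _ _ x∈B y∈B)
        }
        where
        upper-⊆ : ∀ W W₁ W₂ → AgreeOutside W W₁ → AgreeOutside W W₂ →
                  (∀ x y → B x → B y → W₂ ⟨ x , y ⟩) → W₁ ⊆ W₂
        upper-⊆ W W₁ W₂ agree₁ agree₂ full₂ x y xy with B²? x y
        ... | yes (x∈B , y∈B) = full₂ x y x∈B y∈B
        ... | no ∉B = to (agree₂ x y ∉B) (from (agree₁ x y ∉B) xy)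

        lower-⊆ : ∀ W W₁ W₂ → AgreeOutside W₁ W → AgreeOutside W₂ W →
                  (∀ x y → B x → B y → W₁ ⟨ x , y ⟩ ⇔ (toℕ x ℕ.< toℕ y)) →
                  (∀ x y → B x → B y → W₂ ⟨ x , y ⟩ ⇔ (toℕ x ℕ.< toℕ y)) → W₁ ⊆ W₂
        lower-⊆ W W₁ W₂ agree₁ agree₂ linear₁ linear₂ x y xy with B²? x y
        ... | yes (x∈B , y∈B) = from (linear₂ x y x∈B y∈B) (to (linear₁ x y x∈B y∈B) xy)
        ... | no ∉B = from (agree₂ x y ∉B) (to (agree₁ x y ∉B) xy)

        partner : ∀ W → Stage n W → ∃ λ W′ → Stage n W′ × (Fills W W′ ⊎ Fills W′ W)
        partner W (mid@(U⊆W , W⊆V , regular) , sorted) with W ⟨ o , o ⟩?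
        ... | yes oo = W₁ , (mid₁ , λ _ b y _ b∈B y∈B b<y → from (inside b∈B y∈B) (inj₂ b<y)) ,
          inj₂ ((λ x y x∈B y∈B → mk⇔ ([ (λ ()) , id ]′ ∘ to (inside x∈B y∈B))
                                       (from (inside x∈B y∈B) ∘ inj₂))
               , (λ x y x∈B y∈B → full oo x∈B y∈B) , agree-sym {W} {W₁} agree)
          where
          open Regular W U⊆W regular
          open Replacement (Q? 0) (λ {x} {y} {z} → Q-trans 0 {x} {y} {z}) (λ {x} {z} → Q-cotrans 0 {x} {z})
            renaming (replaced-inside to inside; replaced-agrees to agree)
          W₁ : Bip n
          W₁ = proj₁ replaced
          mid₁ : Mid U V W₁
          mid₁ = mid-transfer {W} {W₁} mid agree (λ x∈B y∈B _ → B²⊆V x∈B y∈B)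
            (λ b∈B bb → ⊥-elim ([ (λ ()) , ℕ.<-irrefl refl ]′ (to (inside b∈B b∈B) bb)))
        ... | no ¬oo = W′ , (mid′ , λ ¬oo′ → ⊥-elim (¬oo′ (from (inside o∈B o∈B) (inj₁ (toℕ<n o))))) ,
          inj₁ (linear , (λ x y x∈B y∈B → from (inside x∈B y∈B) (inj₁ (toℕ<n x))) , agree)
          where
          open Regular W U⊆W regular
          open Replacement (Q? n) (λ {x} {y} {z} → Q-trans n {x} {y} {z}) (λ {x} {z} → Q-cotrans n {x} {z})
            renaming (replaced-inside to inside; replaced-agrees to agree)
          W′ : Bip n
          W′ = proj₁ replaced
          mid′ : Mid U V W′
          mid′ = mid-transfer {W} {W′} mid agree (λ x∈B y∈B _ → B²⊆V x∈B y∈B)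
            (λ _ _ x∈B y∈B → from (inside x∈B y∈B) (inj₁ (toℕ<n _)))
          linear : ∀ x y → B x → B y → W ⟨ x , y ⟩ ⇔ (toℕ x ℕ.< toℕ y)
          linear x y x∈B y∈B = mk⇔ ⇒ (sorted ¬oo x y (toℕ<n x) x∈B y∈B)
            where
            ⇒ : W ⟨ x , y ⟩ → toℕ x ℕ.< toℕ y
            ⇒ xy with ℕ.<-cmp (toℕ x) (toℕ y)
            ... | tri< x<y _ _ = x<y
            ... | tri≈ _ x≡y _ = ⊥-elim (loopless ¬oo x∈B (subst (W ⟨ x ,_⟩) (sym (toℕ-injective x≡y)) xy))
            ... | tri> _ _ y<x = ⊥-elim (loopless ¬oo x∈B
                                   (transitive W xy (sorted ¬oo y x (toℕ<n y) y∈B x∈B y<x)))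

      stage-vanishes : ∀ k → signedSum (stage? k) ≡ 0ℤ → signedSum (stage? 0) ≡ 0ℤ
      stage-vanishes zero    eq = eq
      stage-vanishes (suc k) eq = stage-vanishes k
        (signedSum-difference (stage? k) (stage? (suc k))
          (λ (mid , sorted) → mid , λ ¬oo b y b<k → sorted ¬oo b y (ℕ.m<n⇒m<1+n b<k))
          eq (difference-vanishes k))

      vanishes : signedSum (mid? U V) ≡ 0ℤ
      vanishes = trans
        (signedSum-cong (mid? U V) (stage? 0)
          (λ mid → mid , λ _ _ _ ()) proj₁)
        (stage-vanishes n last-stage-vanishes)

  -- Choice of the matching and computation of the Möbius function.

  mid-vanishes : ∀ U V → U ⊆ V → ¬ U ≈ V → signedSum (mid? U V) ≡ 0ℤ
  mid-vanishes U V U⊆V U≉V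
    with any? (λ x → any? λ y → ¬? (U ⟨ x , y ⟩?) ×-dec ¬? (U ⟨ y , x ⟩?) ×-dec V ⟨ x , y ⟩?)
       | any? (λ x → any? λ y → ¬? (U ⟨ x , y ⟩?) ×-dec ¬? (U ⟨ y , x ⟩?)
                               ×-dec V ⟨ x , y ⟩? ×-dec ¬? (V ⟨ y , x ⟩?))
  ... | _ | yes (x , y , ¬Uxy , ¬Uyx , Vxy , ¬Vyx) = SplitByV.vanishes U V ¬Uxy ¬Uyx Vxy ¬Vyx
  -- With no strict pair, V is symmetric within the nonunderlined blocks of U, so relating x to y
  -- forces it to contain the square of their block.
  ... | yes (x , y , ¬Uxy , ¬Uyx , Vxy) | no ¬strict = Flip.vanishes U V x ¬Uxx B²⊆V
    where
    ¬Uxx : ¬ U ⟨ x , x ⟩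
    ¬Uxx xx = [ ¬Uxy , ¬Uyx ]′ (cotransitive U y xx)
    symmetric : ∀ {a b} → ¬ U ⟨ a , b ⟩ → ¬ U ⟨ b , a ⟩ → V ⟨ a , b ⟩ → V ⟨ b , a ⟩
    symmetric {a} {b} ¬ab ¬ba ab = decidable-stable (V ⟨ b , a ⟩?)
      λ ¬Vba → ¬strict (a , b , ¬ab , ¬ba , ab , ¬Vba)
    Vxx : V ⟨ x , x ⟩
    Vxx = transitive V Vxy (symmetric ¬Uxy ¬Uyx Vxy)
    with-x : ∀ {b} → ¬ U ⟨ x , b ⟩ × ¬ U ⟨ b , x ⟩ → V ⟨ x , b ⟩ × V ⟨ b , x ⟩
    with-x {b} (¬xb , ¬bx) = [ (λ xb → xb , symmetric ¬xb ¬bx xb) , (λ bx → symmetric ¬bx ¬xb bx , bx) ]′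
      (cotransitive V b Vxx)
    B²⊆V : ∀ {a b} → ¬ U ⟨ x , a ⟩ × ¬ U ⟨ a , x ⟩ → ¬ U ⟨ x , b ⟩ × ¬ U ⟨ b , x ⟩ → V ⟨ a , b ⟩
    B²⊆V a∈B b∈B = transitive V (proj₂ (with-x a∈B)) (proj₁ (with-x b∈B))
  ... | no none | no _ with strict-witness U V U⊆V U≉V
  ...   | t₀ , s , Vts₀ , ¬Uts₀
    -- Among the t that V, but not U, relates to s, a U-minimal one lies in the block directly after
    -- that of s.
    with minimal (U ⟨_,_⟩?) (transitive U) (λ t → ¬? (U ⟨ t , s ⟩?) ×-dec V ⟨ t , s ⟩?)
                 (t₀ , ¬Uts₀ , Vts₀)
  ...   | t , (¬Uts , Vts) , min = MergeUnderlined.vanishes U V s t adjacent ¬Uts Vts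
    where
    comparable : ∀ {x y} → V ⟨ x , y ⟩ → U ⟨ x , y ⟩ ⊎ U ⟨ y , x ⟩
    comparable {x} {y} Vxy with U ⟨ x , y ⟩? | U ⟨ y , x ⟩?
    ... | yes xy | _      = inj₁ xy
    ... | no _   | yes yx = inj₂ yx
    ... | no ¬xy | no ¬yx = ⊥-elim (none (x , y , ¬xy , ¬yx , Vxy))
    Ust : U ⟨ s , t ⟩
    Ust = [ ⊥-elim ∘ ¬Uts , id ]′ (comparable Vts)
    Uss : U ⟨ s , s ⟩
    Uss = [ id , id ]′ (comparable (transitive V (U⊆V _ _ Ust) Vts))
    adjacent : ∀ z → U ⟨ z , s ⟩ ⊎ U ⟨ t , z ⟩
    adjacent z with U ⟨ z , s ⟩?
    ... | yes zs = inj₁ zs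
    ... | no ¬zs = inj₂ ([ id , (λ zt → min (¬zs , transitive V (U⊆V _ _ zt) Vts) zt) ]′ (comparable
                     (transitive V Vts (U⊆V _ _ sz))))
      where
      sz : U ⟨ s , z ⟩
      sz = [ id , ⊥-elim ∘ ¬zs ]′ (cotransitive U z Uss)

  -- Writing the sign as a product lets the factor of U be pulled out of sums over W and avoids
  -- truncated subtraction.
  möbius : Bip n → Bip n → ℤ
  möbius U W = χ (isRegular? U W) (sign (rk U) * sign (rk W))

  möbius-sum : ∀ {U V} → U ⊆ V → ¬ U ≈ V →
    Σ[ (λ W → χ (FinitePoset._≤?_ (bip n) U W ×-dec FinitePoset._≤?_ (bip n) W V) (möbius U W)) ] ≡ 0ℤ
  möbius-sum {U} {V} U⊆V U≉V = begin
    Σ[ (λ W → χ (U ≤? W ×-dec W ≤? V) (möbius U W)) ]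
      ≡⟨ sum-cong (FinitePoset.elements (bip n)) factor ⟩
    Σ[ (λ W → sign (rk U) * χ (mid? U V W) (sign (rk W))) ]
      ≡⟨ sum-* (FinitePoset.elements (bip n)) (sign (rk U)) _ ⟩
    sign (rk U) * signedSum (mid? U V)
      ≡⟨ cong (sign (rk U) *_) (mid-vanishes U V U⊆V U≉V) ⟩
    sign (rk U) * 0ℤ
      ≡⟨ ℤ.*-zeroʳ (sign (rk U)) ⟩
    0ℤ ∎
    where
    open ≡-Reasoning
    open FinitePoset (bip n) using (_≤?_)
    factor : ∀ W → χ (U ≤? W ×-dec W ≤? V) (möbius U W) ≡ sign (rk U) * χ (mid? U V W) (sign (rk W))
    factor W with U ≤? W | W ≤? V | isRegular? U W
    ... | yes _ | yes _ | yes _ = refl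
    ... | yes _ | yes _ | no  _ = sym (ℤ.*-zeroʳ (sign (rk U)))
    ... | yes _ | no  _ | _     = sym (ℤ.*-zeroʳ (sign (rk U)))
    ... | no  _ | _     | _     = sym (ℤ.*-zeroʳ (sign (rk U)))

  möbius-diagonal : ∀ {U V} → U ≈ V → möbius U V ≡ 1ℤ
  möbius-diagonal {U@(_ , _)} {V@(_ , _)} refl = trans
    (χ-true (isRegular? U V) (λ _ xx ¬xx → ⊥-elim (¬xx xx)))
    (trans (cong (λ k → sign (rk U) * sign k) (rank-cong {V} {U} refl)) (sign-square (rk U)))

  möbius-congʳ : ∀ {U V W} → V ≈ W → möbius U V ≡ möbius U W
  möbius-congʳ {U} {V@(_ , _)} {W@(_ , _)} refl = trans
    (cong (λ k → χ (isRegular? U V) (sign (rk U) * sign k)) (rank-cong {V} {W} refl))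
    (χ-cong (isRegular? U V) (isRegular? U W) id id)

  μ≡möbius : ∀ U V → U ⊆ V → FinitePoset.μ (bip n) U V ≡ möbius U V
  μ≡möbius U V U⊆V = μ-acc-unique möbius (λ {U} {V} {W} → möbius-congʳ {U} {V} {W})
    (λ {U} {V} → möbius-diagonal {U} {V}) (λ {U} {V} (U⊆V , U≉V) → möbius-sum {U} {V} U⊆V U≉V)
    U⊆V (FinitePoset.<-wellFounded (bip n) V)

corollary10p3 : (n : ℕ) (rk : Bip n → ℕ) → FinitePoset.IsRankFunction (bip n) rk →
    (U V : Bip n) → U ⊆ V → IsRegular U V →
    FinitePoset.μ (bip n) U V ≡ -1ℤ ^ (rk V ∸ rk U)
corollary10p3 n rk isRank U V U⊆V regular = begin
  FinitePoset.μ (bip n) U V    ≡⟨ μ≡möbius U V U⊆V ⟩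
  möbius U V                   ≡⟨ χ-true (isRegular? U V) regular ⟩
  -- Monotonicity of the rank makes the truncated subtraction a true difference.
  sign (rk U) * sign (rk V)    ≡⟨ sign-∸ (rank-mono isRank {U} {V} U⊆V) ⟩
  -1ℤ ^ (rk V ∸ rk U)          ∎
  where
  open ≡-Reasoning
  open RankSums isRank
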